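{- Let $p>2$ be a prime, let $n\geq 1$ be an integer, and let $A:=(\mathbb{Z}_p)^n$. Suppose that $A$ satisfies Property D. Then $$ s(A)\leq (p-1)\,p^{\left(1-\frac{(p-2)^2}{2p^2\ln(p)}\right)n+1}+1. $$
   Context: A sequence over a finite abelian group $A$ is a finite unordered list of elements of $A$ with repetitions allowed (an element of the free abelian monoid on $A$); its length is the number of terms counted with multiplicity, a subsequence is a sub-multiset, and a zero-sum sequence is one whose terms sum to $0$. For a sequence $T$, $T^{j}$ denotes the sequence in which every term of $T$ is repeated $j$ times. The exponent $\exp(A)$ is the least common multiple of the orders of elements of $A$. The Erdős–Ginzburg–Ziv constant $s(A)$ is the smallest integer $\ell$ such that every sequence over $A$ of length at least $\ell$ has a zero-sum subsequence of length $\exp(A)$. The group $A=(\mathbb{Z}_k)^n$ is said to satisfy Property D if every sequence $S$ over $A$ of length $s(A)-1$ that has no zero-sum subsequence of length $k$ has the form $S=T^{k-1}$ for some sequence $T$ over $A$. -}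

module Defs where

open import Data.Nat as ℕ using (ℕ; zero; suc; _∸_; _^_; _%_; _≥_; _≡ᵇ_)
open import Data.Fin using (Fin; toℕ)
open import Data.List using (List; length; map; concat; replicate)
open import Data.Nat.ListAction using (sum)
open import Data.List.Relation.Binary.Sublist.Propositional using (_⊆_)
open import Data.List.Relation.Binary.Permutation.Propositional using (_↭_)
open import Data.Product using (Σ; _×_; ∃)
open import Data.Integer using (+_)
open import Data.Rational as ℚ using (ℚ; _/_; 1ℚ; 0ℚ)
open import Relation.Binary.PropositionalEquality using (_≡_)
open import Relation.Nullary using (¬_)

-- The group (Z_p)^n : an element is a function Fin n → Fin p (coordinates mod p).
Elem : ℕ → ℕ → Set
Elem p n = Fin n → Fin p

-- A sequence over (Z_p)^n: a list (order irrelevant; all notions below are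
-- invariant under permutation).
Seq : ℕ → ℕ → Set
Seq p n = List (Elem p n)

ZeroSum : ∀ {p n} → Seq p n → Set
ZeroSum {p} {n} S = ∀ (i : Fin n) → sum (map (λ a → toℕ (a i)) S) % suc (p ∸ 1) ≡ 0

HasZSLen : ∀ {p n} → ℕ → Seq p n → Set
HasZSLen {p} {n} k S = Σ (Seq p n) λ T → (T ⊆ S) × (length T ≡ k) × ZeroSum T

-- ℓ has the EGZ property for (Z_p)^n (exp = p, since n ≥ 1).
EGZBound : ℕ → ℕ → ℕ → Set
EGZBound p n ℓ = ∀ (S : Seq p n) → length S ≥ ℓ → HasZSLen p S

IsEGZConstant : ℕ → ℕ → ℕ → Set
IsEGZConstant p n s = EGZBound p n s × (∀ ℓ → EGZBound p n ℓ → s ℕ.≤ ℓ)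

rep : ∀ {A : Set} → ℕ → List A → List A
rep j T = concat (map (replicate j) T)

-- Property D for (Z_p)^n, given s = s((Z_p)^n).
PropertyD : ℕ → ℕ → ℕ → Set
PropertyD p n s = ∀ (S : Seq p n) → length S ≡ s ∸ 1 → ¬ HasZSLen p S →
  ∃ λ (T : Seq p n) → S ↭ rep (p ∸ 1) T

expTerm : ℚ → ℕ → ℚ
expTerm x zero = 1ℚ
expTerm x (suc j) = expTerm x j ℚ.* x ℚ.* ((+ 1) / suc j)

expPartial : ℚ → ℕ → ℚ
expPartial x zero = 1ℚ
expPartial x (suc k) = expPartial x k ℚ.+ expTerm x (suc k)

-- The rational x(p,n) = (p-2)^2 n / (2 p^2)  (p ≥ 1 required; p = 0 gives a dummy value).
egzX : ℕ → ℕ → ℚ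
egzX zero n = 0ℚ
egzX (suc q) n = (+ ((suc q ∸ 2) ^ 2 ℕ.* n)) / (2 ℕ.* (suc q ^ 2))

-- (s - 1) · e^{x} ≤ M, expressed as: for every k, (s - 1) · Σ_{j≤k} x^j/j! ≤ M.
-- (Equivalent since the partial sums increase to e^x.)
MulExpLe : ℕ → ℚ → ℕ → Set
MulExpLe N x M = ∀ (k : ℕ) → ((+ N) / 1) ℚ.* expPartial x k ℚ.≤ ((+ M) / 1)

{-# OPTIONS --safe #-}

-- If S is extremal then Property D gives S = T^(p−1), and a zero-sum p-tuple of indices of T that
-- is not constant uses each index at most p − 1 times, hence is a zero-sum subsequence of S. So
-- the tensor ∏ᵢ ∏_{v=1}^{p−1} (v − Σⱼ xⱼᵢ) over 𝔽ₚ, which is nonzero exactly on zero-sum p-tuples,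
-- is diagonal on T, and Tao's slice rank argument bounds |T| by p times the number of monomials of
-- degree at most n(p−1)/p with all exponents below p. Chernoff's method counts these. The bound
-- claimed is far from the optimum of that method, which leaves room for rational weights: with
-- x = (p−2)²/2p², the base 2 (for p ≥ 5) or (5/4)³ (for p = 3) already shows that there are at
-- most (p(1 − x))ⁿ of them, and (1 − x)ⁿ times any partial sum of exp(nx) is at most 1.
module Submission where

open import Algebra.Bundles using (CommutativeRing)
open import Data.Empty using (⊥; ⊥-elim)
open import Data.Fin using (Fin; zero; suc; toℕ; punchIn; splitAt; _↑ˡ_; _↑ʳ_)
open import Data.Fin.Properties using (_≟_; all?; any?; ¬∀⟶∃¬; punchIn-injective; punchInᵢ≢i; splitAt-↑ˡ; splitAt-↑ʳ)
open import Data.Integer as ℤ using (ℤ; +_; 0ℤ; 1ℤ)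
open import Data.Integer.Divisibility.Signed as ℤ∣ using (_∣_; divides)
import Data.Integer.Properties as ℤₚ
import Data.Integer.Solver as ℤSolver
open import Data.List as List using (List; []; _∷_; _++_; filter; cartesianProductWith; upTo)
open import Data.List.Membership.Propositional using (_∈_)
open import Data.List.Membership.Propositional.Properties using (∈-cartesianProductWith⁺; ∈-upTo⁺; ∈-filter⁺)
import Data.List.Properties as Listₚ
open import Data.List.Relation.Binary.Permutation.Propositional as ↭ using (_↭_; prep; swap; ↭-sym; ↭-reflexive; module PermutationReasoning)
import Data.List.Relation.Binary.Permutation.Propositional.Properties as Perm
open import Data.List.Relation.Binary.Sublist.Propositional using (_⊆_; []; _∷_; _∷ʳ_; minimum)
open import Data.List.Relation.Binary.Sublist.Propositional.Properties using (++⁺)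
import Data.List.Relation.Unary.All as LAll
import Data.List.Relation.Unary.All.Properties as LAllₚ
open import Data.List.Relation.Unary.Any as ListAny using (here)
open import Data.List.Relation.Unary.Any.Properties using (lookup-index)
open import Data.Nat as ℕ using (ℕ; zero; suc)
import Data.Nat.Divisibility as ℕ∣
open import Data.Nat.DivMod using (m%n<n; m≡m%n+[m/n]*n)
import Data.Nat.ListAction as ℕL
open import Data.Nat.ListAction.Properties using (sum-++; sum-↭)
open import Data.Nat.Primality using (Prime; prime?; euclidsLemma; prime⇒nonTrivial)
import Data.Nat.Properties as ℕₚ
open import Data.Nat.Solver using (module +-*-Solver)
open import Data.Product using (_×_; _,_; ∃; ∃₂)
open import Data.Rational as ℚ using (ℚ; 0ℚ; 1ℚ)
import Data.Rational.Properties as ℚₚ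
import Data.Rational.Solver as ℚSolver
import Data.Rational.Unnormalised as ℚᵘ
import Data.Rational.Unnormalised.Properties as ℚᵘₚ
open import Data.Sum using (_⊎_; inj₁; inj₂; [_,_]′)
open import Data.Vec as Vec using (Vec; []; _∷_; map; replicate; zipWith)
open import Data.Vec.Functional using (insertAt)
open import Data.Vec.Functional.Properties using (insertAt-lookup; insertAt-punchIn)
import Data.Vec.Properties as Vecₚ
open import Data.Vec.Relation.Unary.All as All using (All; []; _∷_)
import Data.Vec.Relation.Unary.All.Properties as VAllₚ
open import Data.Vec.Relation.Unary.Any as Any using (Any; here; there)
open import Function using (_∘_; id)
open import Level using (0ℓ)
open import Relation.Binary.PropositionalEquality as ≡ using (_≡_)
open import Relation.Nullary using (¬_; Dec; yes; no; contradiction; ¬?)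
open import Relation.Nullary.Decidable using (map′; _×-dec_; decidable-stable; from-no)
open import Relation.Unary using (Decidable)

open import Defs

-- Slice rank

-- The factor p counts slots: by pigeonhole every monomial of the expanded tensor has low degree in
-- some slot and is a slice there, and one list of low-degree monomials serves all p slots. A
-- diagonal tensor resists a short decomposition because a slot can be contracted against a vector
-- orthogonal to its r slice functions yet nonzero at all but at most r positions. On those
-- positions the tensor stays diagonal, with one slot fewer.
--
-- The obstacle at the end is logical. Minimality of s does not hand over an extremal sequence; it
-- only refutes that s - 1 has the EGZ property. But for each partial sum of the exponential the
-- claim is a decidable inequality of rationals, so it may be assumed to fail. The EGZ property of s
-- - 1 is then derived by deciding, for each S of that length, whether a zero-sum subsequence
-- exists.
--
-- Tuples consist of indices into T and not of group elements: the latter are functions, whose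
-- propositional equality is awkward, while indices in `Fin` can be compared directly.

record DecIntegralDomain : Set₁ where
  field
    commutativeRing : CommutativeRing 0ℓ 0ℓ
  open CommutativeRing commutativeRing hiding (zero) public
  field
    0?   : ∀ x → Dec (x ≈ 0#)
    1≉0  : 1# ≉ 0#
    *-≉0 : ∀ {x y} → x ≉ 0# → y ≉ 0# → x * y ≉ 0#

module SliceRank (D : DecIntegralDomain) where
  open DecIntegralDomain D
  import Algebra.Properties.Semiring.Sum semiring as Sum
  open import Algebra.Properties.Ring ring using (-‿distribˡ-*; -‿distribʳ-*)
  open import Algebra.Properties.CommutativeSemigroup *-commutativeSemigroup using (x∙yz≈y∙xz; xy∙z≈y∙xz)
  open import Relation.Binary.Reasoning.Setoid setoid

  abstract
    -- Opaque, so that unification can read the summand off a sum.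
    sum : ∀ {m} → (Fin m → Carrier) → Carrier
    sum = Sum.sum

    sum-empty : (f : Fin 0 → Carrier) → sum f ≈ 0#
    sum-empty f = refl

    sum-suc : ∀ {m} (f : Fin (suc m) → Carrier) → sum f ≈ f zero + sum (f ∘ suc)
    sum-suc f = refl

    sum-cong : ∀ {m} {f g : Fin m → Carrier} → (∀ i → f i ≈ g i) → sum f ≈ sum g
    sum-cong = Sum.sum-cong-≋

    sum-+ : ∀ {m} (f g : Fin m → Carrier) → sum (λ i → f i + g i) ≈ sum f + sum g
    sum-+ = Sum.∑-distrib-+

    sum-comm : ∀ {m n} (f : Fin m → Fin n → Carrier) → sum (λ i → sum (f i)) ≈ sum (λ j → sum (λ i → f i j))
    sum-comm = Sum.∑-comm

    *-distribˡ-sum : ∀ {m} c (f : Fin m → Carrier) → c * sum f ≈ sum (λ i → c * f i)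
    *-distribˡ-sum = Sum.*-distribˡ-sum

    *-distribʳ-sum : ∀ {m} c (f : Fin m → Carrier) → sum f * c ≈ sum (λ i → f i * c)
    *-distribʳ-sum = Sum.*-distribʳ-sum

    sum-remove : ∀ {m} j (f : Fin (suc m) → Carrier) → sum f ≈ f j + sum (f ∘ punchIn j)
    sum-remove j f = Sum.sum-remove {i = j} f

    sum-zero : ∀ {m} {f : Fin m → Carrier} → (∀ i → f i ≈ 0#) → sum f ≈ 0#
    sum-zero {m} f≈0 = trans (Sum.sum-cong-≋ f≈0) (Sum.sum-replicate-zero m)

  -- Being nonzero is not enough for the contraction below: the vector must have at least m - r
  -- nonzero entries, and `support` enumerates them without repetition.
  record KernelVector {r m} (f : Fin r → Fin m → Carrier) : Set where
    field
      {size}      : ℕ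
      vector      : Fin m → Carrier
      support     : Fin size → Fin m
      injective   : ∀ {i j} → support i ≡ support j → i ≡ j
      nonzero     : ∀ i → vector (support i) ≉ 0#
      annihilates : ∀ α → sum (λ i → vector i * f α i) ≈ 0#
      large       : m ℕ.≤ size ℕ.+ r

  -- Fraction-free elimination of the pivot j: scaling by f j instead of dividing keeps the
  -- nonzero entries of a kernel vector nonzero.
  module _ {m} (f : Fin (suc m) → Carrier) (j : Fin (suc m)) where

    eliminate : (Fin (suc m) → Carrier) → Fin m → Carrier
    eliminate w i = f j * w (punchIn j i) - w j * f (punchIn j i)

    extend : (Fin m → Carrier) → Fin (suc m) → Carrier
    extend h = insertAt (λ i → f j * h i) j (- sum (λ i → h i * f (punchIn j i)))

    -- The two operations are adjoint, so `extend h` annihilates w as soon as h annihilates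
    -- `eliminate w`. For w = f the eliminated functional is zero, so `extend h` always annihilates
    -- f; this forces its entry at j.
    extend-eliminate : ∀ h w → sum (λ i → extend h i * w i) ≈ sum (λ i → h i * eliminate w i)
    extend-eliminate h w = begin
      sum (λ i → extend h i * w i)
        ≈⟨ sum-remove j (λ i → extend h i * w i) ⟩
      extend h j * w j + sum (λ i → extend h (punchIn j i) * w (punchIn j i))
        ≈⟨ +-cong (*-congʳ (reflexive (insertAt-lookup _ j _)))
                  (sum-cong λ i → *-congʳ (reflexive (insertAt-punchIn _ j _ i))) ⟩
      - sum (λ i → h i * f (punchIn j i)) * w j + sum (λ i → (f j * h i) * w (punchIn j i))
        ≈⟨ +-congʳ (trans (sym (-‿distribˡ-* _ _)) (trans (-‿distribʳ-* _ _) (*-distribʳ-sum _ _))) ⟩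
      sum (λ i → (h i * f (punchIn j i)) * - w j) + sum (λ i → (f j * h i) * w (punchIn j i))
        ≈⟨ sum-+ _ _ ⟨
      sum (λ i → (h i * f (punchIn j i)) * - w j + (f j * h i) * w (punchIn j i))
        ≈⟨ sum-cong term ⟩
      sum (λ i → h i * eliminate w i) ∎
      where
      term : ∀ i → (h i * f (punchIn j i)) * - w j + (f j * h i) * w (punchIn j i) ≈ h i * eliminate w i
      term i = begin
        (h i * f (punchIn j i)) * - w j + (f j * h i) * w (punchIn j i)
          ≈⟨ +-cong (trans (*-assoc _ _ _) (*-congˡ (trans (*-comm _ _) (sym (-‿distribˡ-* _ _)))))
                    (xy∙z≈y∙xz _ _ _) ⟩
        h i * - (w j * f (punchIn j i)) + h i * (f j * w (punchIn j i))
          ≈⟨ trans (+-comm _ _) (sym (distribˡ _ _ _)) ⟩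
        h i * eliminate w i ∎

  -- Each functional costs at most one position of the support, its pivot; a functional that
  -- vanishes identically costs none.
  kernelVector : ∀ {r m} (f : Fin r → Fin m → Carrier) → KernelVector f
  kernelVector {zero} {m} f = record
    { vector = λ _ → 1#
    ; support = id
    ; injective = id
    ; nonzero = λ _ → 1≉0
    ; annihilates = λ ()
    ; large = ℕₚ.≤-reflexive (≡.sym (ℕₚ.+-identityʳ m))
    }
  kernelVector {suc r} f with any? (λ i → ¬? (0? (f zero i)))
  kernelVector {suc r} f | no f₀-zero = record
    { vector = vector
    ; support = support
    ; injective = injective
    ; nonzero = nonzero
    ; annihilates = λ where
        zero    → sum-zero λ i → trans (*-congˡ (decidable-stable (0? _) λ ≉0 → f₀-zero (i , ≉0))) (zeroʳ _)
        (suc α) → annihilates α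
    ; large = ℕₚ.≤-trans large (ℕₚ.+-monoʳ-≤ size (ℕₚ.n≤1+n r))
    }
    where open KernelVector (kernelVector (f ∘ suc))
  kernelVector {suc r} {suc m} f | yes (j , f₀j≉0) = record
    { vector = extend (f zero) j vector
    ; support = punchIn j ∘ support
    ; injective = injective ∘ punchIn-injective j _ _
    ; nonzero = λ i → ≡.subst (_≉ 0#) (≡.sym (insertAt-punchIn _ j _ (support i))) (*-≉0 f₀j≉0 (nonzero i))
    ; annihilates = λ where
        zero    → trans (extend-eliminate (f zero) j vector (f zero))
                        (sum-zero λ i → trans (*-congˡ (-‿inverseʳ _)) (zeroʳ _))
        (suc α) → trans (extend-eliminate (f zero) j vector (f (suc α))) (annihilates α)
    ; large = ℕₚ.≤-trans (ℕ.s≤s large) (ℕₚ.≤-reflexive (≡.sym (ℕₚ.+-suc size r)))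
    }
    where open KernelVector (kernelVector (λ α → eliminate (f zero) j (f (suc α))))

  -- Tensors decomposed into slices

  Tensor : Set → ℕ → Set
  Tensor X k = Vec X k → Carrier

  -- T is a sum of slices φ α (xⱼ) · g(the other xᵢ): those with j the first slot are
  -- collected in `coefficient`, and the rest, with the first slot frozen, in `remainder`.
  data Sliced {r} {X : Set} (φ : Fin r → X → Carrier) : ∀ {k} → Tensor X k → Set where
    nil  : ∀ {T : Tensor X 0} → T [] ≈ 0# → Sliced φ T
    cons : ∀ {k} {T : Tensor X (suc k)}
           (coefficient : Fin r → Tensor X k) (remainder : X → Tensor X k) →
           (∀ x → Sliced φ (remainder x)) →
           (∀ x xs → T (x ∷ xs) ≈ sum (λ α → φ α x * coefficient α xs) + remainder x xs) →
           Sliced φ T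

  module _ {r} {X : Set} {φ : Fin r → X → Carrier} where

    Sliced-resp : ∀ {k} {T T′ : Tensor X k} → (∀ xs → T′ xs ≈ T xs) → Sliced φ T → Sliced φ T′
    Sliced-resp T′≈T (nil T≈0)      = nil (trans (T′≈T []) T≈0)
    Sliced-resp T′≈T (cons G R s T≈) = cons G R s λ x xs → trans (T′≈T _) (T≈ x xs)

    Sliced-zero : ∀ {k} → Sliced φ {k} (λ _ → 0#)
    Sliced-zero {zero}  = nil refl
    Sliced-zero {suc k} = cons (λ _ _ → 0#) (λ _ _ → 0#) (λ _ → Sliced-zero) λ x xs →
      sym (trans (+-identityʳ _) (sum-zero λ α → zeroʳ _))

    Sliced-+ : ∀ {k} {T T′ : Tensor X k} → Sliced φ T → Sliced φ T′ → Sliced φ (λ xs → T xs + T′ xs)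
    Sliced-+ (nil T≈0) (nil T′≈0) = nil (trans (+-cong T≈0 T′≈0) (+-identityʳ _))
    Sliced-+ {T = T} {T′} (cons G R s T≈) (cons G′ R′ s′ T′≈) =
      cons (λ α xs → G α xs + G′ α xs) (λ x xs → R x xs + R′ x xs) (λ x → Sliced-+ (s x) (s′ x)) λ x xs → begin
        T (x ∷ xs) + T′ (x ∷ xs)
          ≈⟨ +-cong (T≈ x xs) (T′≈ x xs) ⟩
        (sum (λ α → φ α x * G α xs) + R x xs) + (sum (λ α → φ α x * G′ α xs) + R′ x xs)
          ≈⟨ interchange _ _ _ _ ⟩
        (sum (λ α → φ α x * G α xs) + sum (λ α → φ α x * G′ α xs)) + (R x xs + R′ x xs)
          ≈⟨ +-congʳ (sum-+ _ _) ⟨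
        sum (λ α → φ α x * G α xs + φ α x * G′ α xs) + (R x xs + R′ x xs)
          ≈⟨ +-congʳ (sum-cong λ α → distribˡ _ _ _) ⟨
        sum (λ α → φ α x * (G α xs + G′ α xs)) + (R x xs + R′ x xs) ∎
      where open import Algebra.Properties.CommutativeSemigroup +-commutativeSemigroup using (interchange)

    Sliced-* : ∀ {k} c {T : Tensor X k} → Sliced φ T → Sliced φ (λ xs → c * T xs)
    Sliced-* c (nil T≈0) = nil (trans (*-congˡ T≈0) (zeroʳ _))
    Sliced-* c {T} (cons G R s T≈) =
      cons (λ α xs → c * G α xs) (λ x xs → c * R x xs) (λ x → Sliced-* c (s x)) λ x xs → begin
        c * T (x ∷ xs)                                              ≈⟨ *-congˡ (T≈ x xs) ⟩
        c * (sum (λ α → φ α x * G α xs) + R x xs)                   ≈⟨ distribˡ _ _ _ ⟩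
        c * sum (λ α → φ α x * G α xs) + c * R x xs                 ≈⟨ +-congʳ (*-distribˡ-sum _ _) ⟩
        sum (λ α → c * (φ α x * G α xs)) + c * R x xs               ≈⟨ +-congʳ (sum-cong λ α → x∙yz≈y∙xz _ _ _) ⟩
        sum (λ α → φ α x * (c * G α xs)) + c * R x xs               ∎

    Sliced-sum : ∀ {k m} (T : Fin m → Tensor X k) → (∀ i → Sliced φ (T i)) → Sliced φ (λ xs → sum (λ i → T i xs))
    Sliced-sum {m = zero}  T s = Sliced-resp (λ xs → sum-empty _) Sliced-zero
    Sliced-sum {m = suc m} T s = Sliced-resp (λ xs → sum-suc _) (Sliced-+ (s zero) (Sliced-sum (T ∘ suc) (s ∘ suc)))

    Sliced-map : ∀ {k} {Y : Set} (e : Y → X) {T : Tensor X k} → Sliced φ T →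
                 Sliced (λ α → φ α ∘ e) (λ ys → T (map e ys))
    Sliced-map e (nil T≈0)       = nil T≈0
    Sliced-map e (cons G R s T≈) =
      cons (λ α → G α ∘ map e) (λ y → R (e y) ∘ map e) (λ y → Sliced-map e (s (e y))) λ y ys → T≈ (e y) (map e ys)

  -- Slices through the first slot pair to zero with h. What survives is a linear combination of the
  -- remainders, which are sliced along the other slots.
  Sliced-contract : ∀ {r m k} {φ : Fin r → Fin m → Carrier} {T : Tensor (Fin m) (suc k)}
                    (h : Fin m → Carrier) → (∀ α → sum (λ i → h i * φ α i) ≈ 0#) →
                    Sliced φ T → Sliced φ (λ xs → sum (λ y → h y * T (y ∷ xs)))
  Sliced-contract {φ = φ} {T} h h⊥φ (cons G R s T≈) =
    Sliced-resp contracted (Sliced-sum _ λ y → Sliced-* (h y) (s y))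
    where
    contracted : ∀ xs → sum (λ y → h y * T (y ∷ xs)) ≈ sum (λ y → h y * R y xs)
    contracted xs = begin
      sum (λ y → h y * T (y ∷ xs))
        ≈⟨ sum-cong (λ y → trans (*-congˡ (T≈ y xs)) (trans (distribˡ _ _ _) (+-congʳ (*-distribˡ-sum _ _)))) ⟩
      sum (λ y → sum (λ α → h y * (φ α y * G α xs)) + h y * R y xs)
        ≈⟨ sum-+ _ _ ⟩
      sum (λ y → sum (λ α → h y * (φ α y * G α xs))) + sum (λ y → h y * R y xs)
        ≈⟨ +-congʳ (sum-comm (λ y α → h y * (φ α y * G α xs))) ⟩
      sum (λ α → sum (λ y → h y * (φ α y * G α xs))) + sum (λ y → h y * R y xs)
        ≈⟨ +-congʳ (sum-zero λ α → begin
             sum (λ y → h y * (φ α y * G α xs))   ≈⟨ sum-cong (λ y → sym (*-assoc _ _ _)) ⟩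
             sum (λ y → (h y * φ α y) * G α xs)   ≈⟨ *-distribʳ-sum _ _ ⟨
             sum (λ y → h y * φ α y) * G α xs     ≈⟨ *-congʳ (h⊥φ α) ⟩
             0# * G α xs                          ≈⟨ zeroˡ _ ⟩
             0#                                   ∎) ⟩
      0# + sum (λ y → h y * R y xs)
        ≈⟨ +-identityˡ _ ⟩
      sum (λ y → h y * R y xs) ∎

  -- Slice rank of diagonal tensors

  record Diagonal {m k} (T : Tensor (Fin m) (suc k)) : Set where
    field
      onDiagonal  : ∀ x → T (x ∷ replicate k x) ≉ 0#
      offDiagonal : ∀ x xs → ¬ All (x ≡_) xs → T (x ∷ xs) ≈ 0#

  sum-single : ∀ {m} (x : Fin m) (f : Fin m → Carrier) → (∀ y → ¬ y ≡ x → f y ≈ 0#) → sum f ≈ f x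
  sum-single {suc m} x f f≈0 = begin
    sum f                              ≈⟨ sum-remove x f ⟩
    f x + sum (λ i → f (punchIn x i))  ≈⟨ +-congˡ (sum-zero λ i → f≈0 _ (punchInᵢ≢i x i)) ⟩
    f x + 0#                           ≈⟨ +-identityʳ _ ⟩
    f x                                ∎

  module _ {m m′ k} (e : Fin m′ → Fin m) (h : Fin m → Carrier)
           {T : Tensor (Fin m) (suc (suc k))} where

    -- The first slot is summed against h over all positions, while the others are restricted along
    -- e to positions where h is nonzero. For diagonal T the sum collapses to one term, so each new
    -- diagonal entry is an old one times a nonzero entry of h.
    contract : Tensor (Fin m′) (suc k)
    contract xs = sum (λ y → h y * T (y ∷ map e xs))

    contract-Sliced : ∀ {r} {φ : Fin r → Fin m → Carrier} → (∀ α → sum (λ i → h i * φ α i) ≈ 0#) → Sliced φ T →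
                      Sliced (λ α → φ α ∘ e) contract
    contract-Sliced h⊥φ s = Sliced-map e (Sliced-contract h h⊥φ s)

    contract-Diagonal : (∀ {i j} → e i ≡ e j → i ≡ j) → (∀ i → h (e i) ≉ 0#) → Diagonal T → Diagonal contract
    contract-Diagonal e-inj h≉0 diag = record
      { onDiagonal = λ x contract≈0 → *-≉0 (h≉0 x) (onDiagonal (e x)) (trans (sym (onDiag x)) contract≈0)
      ; offDiagonal = λ x xs ≢ → sum-zero λ y → trans (*-congˡ (offDiagonal y _ λ where
          (≡.refl ∷ eq) → ≢ (unmap x xs eq))) (zeroʳ _)
      }
      where
      open Diagonal diag
      unmap : ∀ {k} x (xs : Vec _ k) → All (e x ≡_) (map e xs) → All (x ≡_) xs
      unmap x []       []        = []
      unmap x (y ∷ xs) (eq ∷ eqs) = e-inj eq ∷ unmap x xs eqs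
      onDiag : ∀ x → contract (x ∷ replicate k x) ≈ h (e x) * T (e x ∷ e x ∷ replicate k (e x))
      onDiag x = begin
        sum (λ y → h y * T (y ∷ e x ∷ map e (replicate k x)))
          ≈⟨ sum-single (e x) _ (λ y y≢ → trans (*-congˡ (offDiagonal y _ λ where (y≡ ∷ _) → y≢ y≡)) (zeroʳ _)) ⟩
        h (e x) * T (e x ∷ e x ∷ map e (replicate k x))
          ≡⟨ ≡.cong (λ v → h (e x) * T (e x ∷ e x ∷ v)) (Vecₚ.map-replicate e x k) ⟩
        h (e x) * T (e x ∷ e x ∷ replicate k (e x)) ∎

  nil⁻¹ : ∀ {r X} {φ : Fin r → X → Carrier} {T : Tensor X 0} → Sliced φ T → T [] ≈ 0#
  nil⁻¹ (nil T≈0) = T≈0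

  -- Each contraction gives up at most r positions and one slot. The descent has to stop at order
  -- two: a function without zeros is a tensor of order one that can be a single slice on
  -- arbitrarily many points.
  diagonal-bound : ∀ {r m} k {φ : Fin r → Fin m → Carrier} {T : Tensor (Fin m) (2 ℕ.+ k)} →
                   Sliced φ T → Diagonal T → m ℕ.≤ (2 ℕ.+ k) ℕ.* r
  diagonal-bound {r} {m} zero {φ} {T} (cons G R s T≈) diag =
    ℕₚ.≤-trans large (ℕₚ.≤-trans (ℕₚ.+-monoˡ-≤ (r ℕ.+ r) (size≤0 no-support))
      (ℕₚ.≤-reflexive (≡.cong (r ℕ.+_) (≡.sym (ℕₚ.+-identityʳ r)))))
    where
    open Diagonal diag
    -- As a matrix, T has rank at most 2r: for fixed x, its row is a combination of the r
    -- coefficients of the first slot and the r functions φ of the second. A vector orthogonal to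
    -- all of these is killed by a diagonal matrix without zeros on the diagonal, so its support is
    -- empty.
    f : Fin (r ℕ.+ r) → Fin m → Carrier
    f α y = [ (λ β → G β (y ∷ [])) , (λ β → φ β y) ]′ (splitAt r α)
    open KernelVector (kernelVector f)
    ⊥G : ∀ α → sum (λ y → vector y * G α (y ∷ [])) ≈ 0#
    ⊥G α = ≡.subst (λ z → sum (λ y → vector y * [ (λ β → G β (y ∷ [])) , (λ β → φ β y) ]′ z) ≈ 0#)
                   (splitAt-↑ˡ r α r) (annihilates (α ↑ˡ r))
    ⊥φ : ∀ α → sum (λ y → vector y * φ α y) ≈ 0#
    ⊥φ α = ≡.subst (λ z → sum (λ y → vector y * [ (λ β → G β (y ∷ [])) , (λ β → φ β y) ]′ z) ≈ 0#)
                   (splitAt-↑ʳ r r α) (annihilates (r ↑ʳ α))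
    size≤0 : ∀ {size} → (Fin size → ⊥) → size ℕ.≤ 0
    size≤0 {zero}  _     = ℕ.z≤n
    size≤0 {suc _} empty = ⊥-elim (empty zero)
    -- With x frozen, the slices of the first slot become slices in y over the family G, so the
    -- contraction lemma disposes of them too.
    slices-through : ∀ x → Sliced {X = Fin m} (λ α y → G α (y ∷ [])) (λ ys → sum (λ α → φ α x * G α ys))
    slices-through x = cons (λ α _ → φ α x) (λ _ _ → 0#) (λ _ → nil refl) λ where
      y [] → trans (sum-cong λ α → *-comm _ _) (sym (+-identityʳ _))
    no-support : ∀ i → ⊥
    no-support i = *-≉0 (nonzero i) (onDiagonal x) (begin
      vector x * T (x ∷ x ∷ [])
        ≈⟨ sum-single x _ (λ y y≢x → trans (*-congˡ (offDiagonal x _ λ where (x≡y ∷ _) → y≢x (≡.sym x≡y))) (zeroʳ _)) ⟨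
      sum (λ y → vector y * T (x ∷ y ∷ []))
        ≈⟨ sum-cong (λ y → trans (*-congˡ (T≈ x (y ∷ []))) (distribˡ _ _ _)) ⟩
      sum (λ y → vector y * sum (λ α → φ α x * G α (y ∷ [])) + vector y * R x (y ∷ []))
        ≈⟨ sum-+ _ _ ⟩
      sum (λ y → vector y * sum (λ α → φ α x * G α (y ∷ []))) + sum (λ y → vector y * R x (y ∷ []))
        ≈⟨ +-cong (nil⁻¹ (Sliced-contract vector ⊥G (slices-through x))) (nil⁻¹ (Sliced-contract vector ⊥φ (s x))) ⟩
      0# + 0#
        ≈⟨ +-identityˡ _ ⟩
      0# ∎)
      where x = support i
  diagonal-bound {r} {m} (suc k) {φ} {T} sliced diag =
    ℕₚ.≤-trans large (ℕₚ.≤-trans (ℕₚ.+-monoˡ-≤ r (diagonal-bound k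
      (contract-Sliced support vector {T = T} annihilates sliced) (contract-Diagonal support vector {T = T} injective nonzero diag)))
      (ℕₚ.≤-reflexive (ℕₚ.+-comm _ r)))
    where open KernelVector (kernelVector φ)

-- Polynomial tensors

-- In an exponent matrix the rows are the slots and the columns are the coordinates of the group.
total : ∀ {n k} → Vec (Vec ℕ n) k → ℕ
total = Vec.sum ∘ map Vec.sum

total-zipWith-∷ : ∀ {n k} (e : Vec ℕ k) (A : Vec (Vec ℕ n) k) → total (zipWith _∷_ e A) ≡ Vec.sum e ℕ.+ total A
total-zipWith-∷ []      []      = ≡.refl
total-zipWith-∷ (i ∷ e) (a ∷ A) = ≡.trans (≡.cong (i ℕ.+ Vec.sum a ℕ.+_) (total-zipWith-∷ e A))
  (interchange i (Vec.sum a) (Vec.sum e) (total A))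
  where open import Algebra.Properties.CommutativeSemigroup ℕₚ.+-commutativeSemigroup using (interchange)

total-[] : ∀ {k} (A : Vec (Vec ℕ 0) k) → total A ≡ 0
total-[] []       = ≡.refl
total-[] ([] ∷ A) = total-[] A

sum-zipWith-+ : ∀ {k} (e e′ : Vec ℕ k) → Vec.sum (zipWith ℕ._+_ e e′) ≡ Vec.sum e ℕ.+ Vec.sum e′
sum-zipWith-+ []      []        = ≡.refl
sum-zipWith-+ (i ∷ e) (i′ ∷ e′) = ≡.trans (≡.cong (i ℕ.+ i′ ℕ.+_) (sum-zipWith-+ e e′))
  (interchange i i′ (Vec.sum e) (Vec.sum e′))
  where open import Algebra.Properties.CommutativeSemigroup ℕₚ.+-commutativeSemigroup using (interchange)

All-≤-sum : ∀ {k d} (e : Vec ℕ k) → Vec.sum e ℕ.≤ d → All (ℕ._≤ d) e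
All-≤-sum []      _   = []
All-≤-sum (i ∷ e) e≤d = ℕₚ.m+n≤o⇒m≤o i e≤d ∷ All-≤-sum e (ℕₚ.m+n≤o⇒n≤o i e≤d)

-- Pigeonhole: if every row sum exceeded b / (k + 1), the total would exceed b.
small-row : ∀ {n k} b (A : Vec (Vec ℕ n) (suc k)) → total A ℕ.≤ b → Any (λ a → suc k ℕ.* Vec.sum a ℕ.≤ b) A
small-row {n} {k} b A tot≤b with Any.any? (λ a → suc k ℕ.* Vec.sum a ℕ.≤? b) A
... | yes small = small
... | no ¬small = contradiction tot≤b (ℕₚ.<⇒≱ (ℕₚ.*-cancelˡ-≤ (suc k) (bound A (none-small A ¬small))))
  where
  none-small : ∀ {j} (A : Vec (Vec ℕ n) j) → ¬ Any (λ a → suc k ℕ.* Vec.sum a ℕ.≤ b) A → All (λ a → b ℕ.< suc k ℕ.* Vec.sum a) A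
  none-small []      _  = []
  none-small (a ∷ A) ¬s = ℕₚ.≰⇒> (¬s ∘ here) ∷ none-small A (¬s ∘ there)
  bound : ∀ {j} (A : Vec (Vec ℕ n) j) → All (λ a → b ℕ.< suc k ℕ.* Vec.sum a) A → j ℕ.* suc b ℕ.≤ suc k ℕ.* total A
  bound []      []       = ℕ.z≤n
  bound (a ∷ A) (s ∷ ss) = ℕₚ.≤-trans (ℕₚ.+-mono-≤ s (bound A ss)) (ℕₚ.≤-reflexive (≡.sym (ℕₚ.*-distribˡ-+ (suc k) (Vec.sum a) (total A))))

module Monomials (D : DecIntegralDomain) where
  open DecIntegralDomain D
  open SliceRank D
  open import Algebra.Properties.Semiring.Exp semiring using (_^_; ^-homo-*)
  open import Algebra.Properties.CommutativeSemigroup *-commutativeSemigroup using (interchange; x∙yz≈y∙xz)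
  open import Algebra.Properties.Ring ring using (-1*x≈-x)
  open import Algebra.Properties.Group +-group using (x∙y⁻¹≈ε⇒x≈y)
  open import Relation.Binary.Reasoning.Setoid setoid

  -- Linear combinations are kept as derivations, so that degree bounds and slicings pass to them by
  -- induction and no coefficient of an expanded product is ever computed.
  data Span {X k} (B : Tensor X k → Set) : Tensor X k → Set where
    base : ∀ {T} → B T → Span B T
    0ˢ   : Span B (λ _ → 0#)
    _+ˢ_ : ∀ {T T′} → Span B T → Span B T′ → Span B (λ xs → T xs + T′ xs)
    _*ˢ_ : ∀ c {T} → Span B T → Span B (λ xs → c * T xs)
    resp : ∀ {T T′} → (∀ xs → T′ xs ≈ T xs) → Span B T → Span B T′

  module _ {X k} {B B′ B″ : Tensor X k → Set}
           (closed : ∀ {T T′} → B T → B′ T′ → Span B″ (λ xs → T xs * T′ xs)) where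

    Span-baseˡ : ∀ {T T′} → B T → Span B′ T′ → Span B″ (λ xs → T xs * T′ xs)
    Span-baseˡ b (base b′)    = closed b b′
    Span-baseˡ b 0ˢ           = resp (λ xs → zeroʳ _) 0ˢ
    Span-baseˡ b (s +ˢ s′)    = resp (λ xs → distribˡ _ _ _) (Span-baseˡ b s +ˢ Span-baseˡ b s′)
    Span-baseˡ b (c *ˢ s)     = resp (λ xs → x∙yz≈y∙xz _ _ _) (c *ˢ Span-baseˡ b s)
    Span-baseˡ b (resp eq s)  = resp (λ xs → *-congˡ (eq xs)) (Span-baseˡ b s)

    Span-product : ∀ {T T′} → Span B T → Span B′ T′ → Span B″ (λ xs → T xs * T′ xs)
    Span-product (base b)    t = Span-baseˡ b t
    Span-product 0ˢ          t = resp (λ xs → zeroˡ _) 0ˢ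
    Span-product (s +ˢ s′)   t = resp (λ xs → distribʳ _ _ _) (Span-product s t +ˢ Span-product s′ t)
    Span-product (c *ˢ s)    t = resp (λ xs → *-assoc _ _ _) (c *ˢ Span-product s t)
    Span-product (resp eq s) t = resp (λ xs → *-congʳ (eq xs)) (Span-product s t)

  Span-Sliced : ∀ {r X k} {φ : Fin r → X → Carrier} {B : Tensor X k → Set} →
                (∀ {T} → B T → Sliced φ T) → ∀ {T} → Span B T → Sliced φ T
  Span-Sliced sl (base b)    = sl b
  Span-Sliced sl 0ˢ          = Sliced-zero
  Span-Sliced sl (s +ˢ s′)   = Sliced-+ (Span-Sliced sl s) (Span-Sliced sl s′)
  Span-Sliced sl (c *ˢ s)    = Sliced-* c (Span-Sliced sl s)
  Span-Sliced sl (resp eq s) = Sliced-resp eq (Span-Sliced sl s)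

  pure : ∀ {I X : Set} {k} → (I → X → Carrier) → Vec I k → Tensor X k
  pure φ []      []       = 1#
  pure φ (a ∷ A) (x ∷ xs) = φ a x * pure φ A xs

  -- A product over the slots is a single slice along any slot whose factor is listed in L; all
  -- other members of the family get coefficient zero.
  pure-Sliced : ∀ {I X : Set} {k} (φ : I → X → Carrier) (L : List I) (A : Vec I k) →
                Any (_∈ L) A → Sliced (φ ∘ List.lookup L) (pure φ A)
  pure-Sliced {X = X} φ L (a ∷ A) (here a∈L) = cons coefficient (λ _ _ → 0#) (λ _ → Sliced-zero) λ x xs → sym (begin
    sum (λ α → φ (List.lookup L α) x * coefficient α xs) + 0#
      ≈⟨ +-identityʳ _ ⟩
    sum (λ α → φ (List.lookup L α) x * coefficient α xs)
      ≈⟨ sum-single i _ (λ β β≢i → trans (*-congˡ (coefficient-≢ β β≢i xs)) (zeroʳ _)) ⟩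
    φ (List.lookup L i) x * coefficient i xs
      ≈⟨ *-cong (reflexive (≡.cong (λ b → φ b x) (≡.sym (lookup-index a∈L)))) (coefficient-≡ xs) ⟩
    φ a x * pure φ A xs ∎)
    where
    i = ListAny.index a∈L
    coefficient : Fin (List.length L) → Tensor X _
    coefficient β xs with β ≟ i
    ... | yes _ = pure φ A xs
    ... | no  _ = 0#
    coefficient-≡ : ∀ xs → coefficient i xs ≈ pure φ A xs
    coefficient-≡ xs with i ≟ i
    ... | yes _  = refl
    ... | no i≢i = contradiction ≡.refl i≢i
    coefficient-≢ : ∀ β → ¬ β ≡ i → ∀ xs → coefficient β xs ≈ 0#
    coefficient-≢ β β≢i xs with β ≟ i
    ... | yes β≡i = contradiction β≡i β≢i
    ... | no  _   = refl
  pure-Sliced φ L (a ∷ A) (there A∈L) =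
    cons (λ _ _ → 0#) (λ x xs → φ a x * pure φ A xs) (λ x → Sliced-* (φ a x) (pure-Sliced φ L A A∈L)) λ x xs →
      sym (trans (+-congʳ (sum-zero λ α → zeroʳ _)) (+-identityˡ _))

  power : {X : Set} → (X → Carrier) → ℕ → X → Carrier
  power y i x = y x ^ i

  monomial : ∀ {n} {X : Set} → (X → Fin n → Carrier) → Vec ℕ n → X → Carrier
  monomial v []      x = 1#
  monomial v (i ∷ a) x = v x zero ^ i * monomial (λ x → v x ∘ suc) a x

  module _ {X : Set} (y : X → Carrier) where

    pure-zeros : ∀ k (xs : Vec X k) → pure (power y) (replicate k 0) xs ≈ 1#
    pure-zeros zero    []       = refl
    pure-zeros (suc k) (x ∷ xs) = trans (*-identityˡ _) (pure-zeros k xs)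

    pure-zipWith-+ : ∀ {k} (e e′ : Vec ℕ k) (xs : Vec X k) →
                     pure (power y) e xs * pure (power y) e′ xs ≈ pure (power y) (zipWith ℕ._+_ e e′) xs
    pure-zipWith-+ []      []        []       = *-identityˡ _
    pure-zipWith-+ (i ∷ e) (i′ ∷ e′) (x ∷ xs) = begin
      (y x ^ i * pure (power y) e xs) * (y x ^ i′ * pure (power y) e′ xs)
        ≈⟨ interchange _ _ _ _ ⟩
      (y x ^ i * y x ^ i′) * (pure (power y) e xs * pure (power y) e′ xs)
        ≈⟨ *-cong (sym (^-homo-* (y x) i i′)) (pure-zipWith-+ e e′ xs) ⟩
      y x ^ (i ℕ.+ i′) * pure (power y) (zipWith ℕ._+_ e e′) xs ∎

    data Univariate {k} (d : ℕ) : Tensor X k → Set where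
      univariate : ∀ e → Vec.sum e ℕ.≤ d → Univariate d (pure (power y) e)

    Univariate-* : ∀ {k d d′} {T T′ : Tensor X k} → Univariate d T → Univariate d′ T′ →
                   Span (Univariate (d ℕ.+ d′)) (λ xs → T xs * T′ xs)
    Univariate-* (univariate e e≤d) (univariate e′ e′≤d′) =
      resp (pure-zipWith-+ e e′) (base (univariate (zipWith ℕ._+_ e e′)
        (ℕₚ.≤-trans (ℕₚ.≤-reflexive (sum-zipWith-+ e e′)) (ℕₚ.+-mono-≤ e≤d e′≤d′))))

    Univariate-const : ∀ {k} c d → Span (Univariate {k} d) (λ _ → c)
    Univariate-const {k} c d = resp (λ xs → sym (trans (*-congˡ (pure-zeros k xs)) (*-identityʳ c)))
      (c *ˢ base (univariate (replicate k 0) (ℕₚ.≤-trans (ℕₚ.≤-reflexive (sum-zeros k)) ℕ.z≤n)))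
      where
      sum-zeros : ∀ k → Vec.sum (replicate k 0) ≡ 0
      sum-zeros zero    = ≡.refl
      sum-zeros (suc k) = sum-zeros k

    slotSum : ∀ {k} → Tensor X k
    slotSum []       = 0#
    slotSum (x ∷ xs) = y x + slotSum xs

    Univariate-slotSum : ∀ k → Span (Univariate {k} 1) slotSum
    Univariate-slotSum zero    = resp (λ where [] → refl) 0ˢ
    Univariate-slotSum (suc k) = resp split (base (univariate (1 ∷ replicate k 0) (s≤ k)) +ˢ weaken (Univariate-slotSum k))
      where
      s≤ : ∀ k → suc (Vec.sum (replicate k 0)) ℕ.≤ 1
      s≤ zero = ℕₚ.≤-refl
      s≤ (suc k) = s≤ k
      split : ∀ xs → slotSum xs ≈ pure (power y) (1 ∷ replicate k 0) xs + slotSum (Vec.tail xs)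
      split (x ∷ xs) = +-congʳ (sym (trans (*-cong (*-identityʳ _) (pure-zeros k xs)) (*-identityʳ _)))
      weaken : ∀ {T} → Span (Univariate {k} 1) T → Span (Univariate {suc k} 1) (T ∘ Vec.tail)
      weaken (base (univariate e e≤)) = resp (λ where (x ∷ xs) → sym (*-identityˡ _)) (base (univariate (0 ∷ e) e≤))
      weaken 0ˢ          = 0ˢ
      weaken (s +ˢ s′)   = weaken s +ˢ weaken s′
      weaken (c *ˢ s)    = c *ˢ weaken s
      weaken (resp eq s) = resp (λ xs → eq (Vec.tail xs)) (weaken s)

    module _ (ι : ℕ → Carrier) where

      -- For ι v = v and d = p − 1 this is nonzero in 𝔽ₚ exactly when slotSum vanishes; unlike
      -- 1 − slotSum^(p−1), it needs no appeal to Fermat's little theorem.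
      detector : ∀ {k} → ℕ → Tensor X k
      detector zero    xs = 1#
      detector (suc d) xs = (ι (suc d) - slotSum xs) * detector d xs

      detector-Univariate : ∀ {k} d → Span (Univariate {k} d) (detector d)
      detector-Univariate zero    = Univariate-const 1# 0
      detector-Univariate (suc d) = Span-product Univariate-*
        (resp (λ xs → +-congˡ (sym (-1*x≈-x _))) (Univariate-const _ 1 +ˢ (_ *ˢ Univariate-slotSum _)))
        (detector-Univariate d)

      detector-≈0 : ∀ {k d v} {xs : Vec X k} → 1 ℕ.≤ v → v ℕ.≤ d → ι v ≈ slotSum xs → detector d xs ≈ 0#
      detector-≈0 {d = zero}      1≤v v≤0 _ = contradiction v≤0 (ℕₚ.<⇒≱ 1≤v)
      detector-≈0 {d = suc d} {v} 1≤v v≤d v≈ with ℕₚ.m≤n⇒m<n∨m≡n v≤d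
      ... | inj₁ (ℕ.s≤s v≤d′) = trans (*-congˡ (detector-≈0 1≤v v≤d′ v≈)) (zeroʳ _)
      ... | inj₂ ≡.refl       = trans (*-congʳ (trans (+-congʳ v≈) (-‿inverseʳ _))) (zeroˡ _)

      detector-≉0 : ∀ {k} d {xs : Vec X k} → (∀ v → 1 ℕ.≤ v → v ℕ.≤ d → ι v ≉ slotSum xs) → detector d xs ≉ 0#
      detector-≉0 zero    _  = 1≉0
      detector-≉0 (suc d) ι≉ = *-≉0 (ι≉ (suc d) (ℕ.s≤s ℕ.z≤n) ℕₚ.≤-refl ∘ x∙y⁻¹≈ε⇒x≈y _ _)
        (detector-≉0 d λ v 1≤v v≤d → ι≉ v 1≤v (ℕₚ.m≤n⇒m≤1+n v≤d))

  Bounded : ∀ {n k} → ℕ → Vec (Vec ℕ n) k → Set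
  Bounded {n} d A = total A ℕ.≤ n ℕ.* d × All (All (ℕ._≤ d)) A

  data Multivariate {X n k} (v : X → Fin n → Carrier) (d : ℕ) : Tensor X k → Set where
    multivariate : ∀ A → Bounded d A → Multivariate v d (pure (monomial v) A)

  module _ (ι : ℕ → Carrier) {X : Set} where

    detectors : ∀ {n k} → (X → Fin n → Carrier) → ℕ → Tensor X k
    detectors {zero}  v d xs = 1#
    detectors {suc n} v d xs = detector (λ x → v x zero) ι d xs * detectors (λ x → v x ∘ suc) d xs

    detectors-≈0 : ∀ {n k d} {v : X → Fin n → Carrier} {xs : Vec X k} i →
                   detector (λ x → v x i) ι d xs ≈ 0# → detectors v d xs ≈ 0#
    detectors-≈0 zero    ≈0 = trans (*-congʳ ≈0) (zeroˡ _)
    detectors-≈0 (suc i) ≈0 = trans (*-congˡ (detectors-≈0 i ≈0)) (zeroʳ _)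

    detectors-≉0 : ∀ {n k d} {v : X → Fin n → Carrier} {xs : Vec X k} →
                   (∀ i → detector (λ x → v x i) ι d xs ≉ 0#) → detectors v d xs ≉ 0#
    detectors-≉0 {zero}  _  = 1≉0
    detectors-≉0 {suc n} ≉0 = *-≉0 (≉0 zero) (detectors-≉0 (≉0 ∘ suc))

    -- The exponents of the new coordinate form a column with sum at most d. This raises the total
    -- by at most d and also keeps each entry at most d, so exponents stay below p without any
    -- reduction.
    Multivariate-∷ : ∀ {n k d} (v : X → Fin (suc n) → Carrier) {T T′ : Tensor X k} →
                     Univariate (λ x → v x zero) d T → Multivariate (λ x → v x ∘ suc) d T′ →
                     Span (Multivariate v d) (λ xs → T xs * T′ xs)
    Multivariate-∷ v (univariate e e≤d) (multivariate A (A≤ , entries)) =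
      resp (pure-zipWith-∷ e A) (base (multivariate _
        ( ℕₚ.≤-trans (ℕₚ.≤-reflexive (total-zipWith-∷ e A)) (ℕₚ.+-mono-≤ e≤d A≤)
        , All-zipWith-∷ (All-≤-sum e e≤d) entries )))
      where
      All-zipWith-∷ : ∀ {n k d} {e : Vec ℕ k} {A : Vec (Vec ℕ n) k} →
                      All (ℕ._≤ d) e → All (All (ℕ._≤ d)) A → All (All (ℕ._≤ d)) (zipWith _∷_ e A)
      All-zipWith-∷ []       []       = []
      All-zipWith-∷ (p ∷ ps) (q ∷ qs) = (p ∷ q) ∷ All-zipWith-∷ ps qs
      pure-zipWith-∷ : ∀ {k} (e : Vec ℕ k) A (xs : Vec X k) →
        pure (power (λ x → v x zero)) e xs * pure (monomial (λ x → v x ∘ suc)) A xs ≈ pure (monomial v) (zipWith _∷_ e A) xs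
      pure-zipWith-∷ []      []      []       = *-identityˡ _
      pure-zipWith-∷ (i ∷ e) (a ∷ A) (x ∷ xs) = trans (interchange _ _ _ _) (*-congˡ (pure-zipWith-∷ e A xs))

    detectors-Multivariate : ∀ {n k} (v : X → Fin n → Carrier) d → Span (Multivariate {k = k} v d) (detectors v d)
    detectors-Multivariate {zero} {k} v d = resp (λ xs → sym (pure-empty k xs))
      (base (multivariate (replicate k []) (ℕₚ.≤-reflexive (total-[] (replicate k [])) , All-empty k)))
      where
      pure-empty : ∀ k (xs : Vec X k) → pure (monomial v) (replicate k []) xs ≈ 1#
      pure-empty zero    []       = refl
      pure-empty (suc k) (x ∷ xs) = trans (*-identityˡ _) (pure-empty k xs)
      All-empty : ∀ k → All (All (ℕ._≤ d)) (replicate k [])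
      All-empty zero    = []
      All-empty (suc k) = [] ∷ All-empty k
    detectors-Multivariate {suc n} v d = Span-product (Multivariate-∷ v)
      (detector-Univariate (λ x → v x zero) ι d) (detectors-Multivariate (λ x → v x ∘ suc) d)

    detectors-Sliced : ∀ {n k} (v : X → Fin n → Carrier) d (L : List (Vec ℕ n)) →
                       (∀ {a} → All (ℕ._≤ d) a → suc k ℕ.* Vec.sum a ℕ.≤ n ℕ.* d → a ∈ L) →
                       Sliced (monomial v ∘ List.lookup L) (detectors {k = suc k} v d)
    detectors-Sliced {n} {k} v d L complete = Span-Sliced sliced (detectors-Multivariate v d)
      where
      combine : ∀ {j} {A : Vec (Vec ℕ n) j} → All (All (ℕ._≤ d)) A → Any (λ a → suc k ℕ.* Vec.sum a ℕ.≤ n ℕ.* d) A → Any (_∈ L) A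
      combine (bd ∷ _)  (here small) = here (complete bd small)
      combine (_ ∷ bds) (there any)  = there (combine bds any)
      sliced : ∀ {T : Tensor X (suc k)} → Multivariate v d T → Sliced (monomial v ∘ List.lookup L) T
      sliced (multivariate A (A≤ , entries)) = pure-Sliced (monomial v) L A (combine entries (small-row _ A A≤))

-- Zero-sum subsequences

module ModPrime {p} (prime-p : Prime p) where
  open import Data.Integer using (_+_; _*_; -_; _-_)

  -- 𝔽ₚ is taken as ℤ with congruence as its equality. No inverses have to be constructed, since the
  -- slice rank argument asks only for an integral domain. Being a record, the relation lets x and y
  -- be inferred, which divisibility of x - y would not.
  record _≈ₚ_ (x y : ℤ) : Set where
    constructor congruent
    field
      divisible : + p ∣ x - y

  private
    transport : ∀ {x y} → x ≡ y → + p ∣ x → + p ∣ y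
    transport eq = ≡.subst (+ p ∣_) eq

    ≡⇒≈ₚ : ∀ {x y} → x ≡ y → x ≈ₚ y
    ≡⇒≈ₚ {x} ≡.refl = congruent (divides 0ℤ (ℤₚ.+-inverseʳ x))

    open ℤSolver.+-*-Solver

    ≈ₚ-sym : ∀ {x y} → x ≈ₚ y → y ≈ₚ x
    ≈ₚ-sym {x} {y} (congruent d) = congruent (transport
      (solve 2 (λ x y → :- (x :- y) := y :- x) ≡.refl x y) (ℤ∣.∣m⇒∣-m d))

    ≈ₚ-trans : ∀ {x y z} → x ≈ₚ y → y ≈ₚ z → x ≈ₚ z
    ≈ₚ-trans {x} {y} {z} (congruent d) (congruent d′) = congruent (transport
      (solve 3 (λ x y z → (x :- y) :+ (y :- z) := x :- z) ≡.refl x y z) (ℤ∣.∣m∣n⇒∣m+n d d′))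

    +-cong : ∀ {x x′ y y′} → x ≈ₚ x′ → y ≈ₚ y′ → (x + y) ≈ₚ (x′ + y′)
    +-cong {x} {x′} {y} {y′} (congruent d) (congruent d′) = congruent (transport
      (solve 4 (λ x x′ y y′ → (x :- x′) :+ (y :- y′) := (x :+ y) :- (x′ :+ y′)) ≡.refl x x′ y y′) (ℤ∣.∣m∣n⇒∣m+n d d′))

    *-cong : ∀ {x x′ y y′} → x ≈ₚ x′ → y ≈ₚ y′ → (x * y) ≈ₚ (x′ * y′)
    *-cong {x} {x′} {y} {y′} (congruent d) (congruent d′) = congruent (transport
      (solve 4 (λ x x′ y y′ → y :* (x :- x′) :+ x′ :* (y :- y′) := (x :* y) :- (x′ :* y′)) ≡.refl x x′ y y′)
      (ℤ∣.∣m∣n⇒∣m+n (ℤ∣.∣n⇒∣m*n y d) (ℤ∣.∣n⇒∣m*n x′ d′)))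

    neg-cong : ∀ {x x′} → x ≈ₚ x′ → (- x) ≈ₚ (- x′)
    neg-cong {x} {x′} (congruent d) = congruent (transport
      (solve 2 (λ x x′ → :- (x :- x′) := (:- x) :- (:- x′)) ≡.refl x x′) (ℤ∣.∣m⇒∣-m d))

  ≈0⇒∣ : ∀ {x} → x ≈ₚ 0ℤ → p ℕ∣.∣ ℤ.∣ x ∣
  ≈0⇒∣ {x} (congruent d) = ℤ∣.∣⇒∣ᵤ (transport (ℤₚ.+-identityʳ x) d)

  ∣⇒≈0 : ∀ {x} → p ℕ∣.∣ ℤ.∣ x ∣ → x ≈ₚ 0ℤ
  ∣⇒≈0 {x} d = congruent (transport (≡.sym (ℤₚ.+-identityʳ x)) (ℤ∣.∣ᵤ⇒∣ d))

  ℤ/p : DecIntegralDomain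
  ℤ/p = record
    { commutativeRing = record
      { Carrier = ℤ ; _≈_ = _≈ₚ_ ; _+_ = _+_ ; _*_ = _*_ ; -_ = -_ ; 0# = 0ℤ ; 1# = 1ℤ
      ; isCommutativeRing = record
        { isRing = record
          { +-isAbelianGroup = record
            { isGroup = record
              { isMonoid = record
                { isSemigroup = record
                  { isMagma = record
                    { isEquivalence = record { refl = ≡⇒≈ₚ ≡.refl ; sym = ≈ₚ-sym ; trans = ≈ₚ-trans }
                    ; ∙-cong = +-cong }
                  ; assoc = λ x y z → ≡⇒≈ₚ (ℤₚ.+-assoc x y z) }
                ; identity = (λ x → ≡⇒≈ₚ (ℤₚ.+-identityˡ x)) , (λ x → ≡⇒≈ₚ (ℤₚ.+-identityʳ x)) }
              ; inverse = (λ x → ≡⇒≈ₚ (ℤₚ.+-inverseˡ x)) , (λ x → ≡⇒≈ₚ (ℤₚ.+-inverseʳ x))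
              ; ⁻¹-cong = neg-cong }
            ; comm = λ x y → ≡⇒≈ₚ (ℤₚ.+-comm x y) }
          ; *-cong = *-cong
          ; *-assoc = λ x y z → ≡⇒≈ₚ (ℤₚ.*-assoc x y z)
          ; *-identity = (λ x → ≡⇒≈ₚ (ℤₚ.*-identityˡ x)) , (λ x → ≡⇒≈ₚ (ℤₚ.*-identityʳ x))
          ; distrib = (λ x y z → ≡⇒≈ₚ (ℤₚ.*-distribˡ-+ x y z)) , (λ x y z → ≡⇒≈ₚ (ℤₚ.*-distribʳ-+ x y z)) }
        ; *-comm = λ x y → ≡⇒≈ₚ (ℤₚ.*-comm x y) } }
    ; 0? = λ x → map′ ∣⇒≈0 ≈0⇒∣ (p ℕ∣.∣? ℤ.∣ x ∣)
    ; 1≉0 = λ 1≈0 → contradiction (ℕ∣.∣1⇒≡1 (≈0⇒∣ 1≈0)) (ℕ.nonTrivial⇒≢1 {{prime⇒nonTrivial prime-p}})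
    ; *-≉0 = λ {x} {y} x≉0 y≉0 xy≈0 → [ x≉0 ∘ ∣⇒≈0 , y≉0 ∘ ∣⇒≈0 ]′
        (euclidsLemma ℤ.∣ x ∣ ℤ.∣ y ∣ prime-p (≡.subst (p ℕ∣.∣_) (ℤₚ.abs-* x y) (≈0⇒∣ xy≈0)))
    }

-- Sublists up to permutation

module _ {A : Set} where

  -- Property D describes S only up to order, so a subsequence found in `rep (p ∸ 1) T` has to be
  -- carried over to S.
  ⊆-resp-↭ : ∀ {S S′ U : List A} → S ↭ S′ → U ⊆ S → ∃ λ U′ → U′ ⊆ S′ × U ↭ U′
  ⊆-resp-↭ ↭.refl       s = _ , s , ↭.refl
  ⊆-resp-↭ (prep x σ)   (.x ∷ʳ s) = let U′ , s′ , τ = ⊆-resp-↭ σ s in U′ , x ∷ʳ s′ , τ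
  ⊆-resp-↭ (prep x σ)   (≡.refl ∷ s) = let U′ , s′ , τ = ⊆-resp-↭ σ s in x ∷ U′ , ≡.refl ∷ s′ , prep x τ
  ⊆-resp-↭ (swap x y σ) (.x ∷ʳ (.y ∷ʳ s)) = let U′ , s′ , τ = ⊆-resp-↭ σ s in U′ , y ∷ʳ (x ∷ʳ s′) , τ
  ⊆-resp-↭ (swap x y σ) (.x ∷ʳ (≡.refl ∷ s)) = let U′ , s′ , τ = ⊆-resp-↭ σ s in y ∷ U′ , ≡.refl ∷ (x ∷ʳ s′) , prep y τ
  ⊆-resp-↭ (swap x y σ) (≡.refl ∷ (.y ∷ʳ s)) = let U′ , s′ , τ = ⊆-resp-↭ σ s in x ∷ U′ , y ∷ʳ (≡.refl ∷ s′) , prep x τ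
  ⊆-resp-↭ (swap x y σ) (≡.refl ∷ (≡.refl ∷ s)) = let U′ , s′ , τ = ⊆-resp-↭ σ s in y ∷ x ∷ U′ , ≡.refl ∷ (≡.refl ∷ s′) , swap x y τ
  ⊆-resp-↭ (↭.trans σ τ) s = let U′ , s′ , ρ = ⊆-resp-↭ σ s ; U″ , s″ , ρ′ = ⊆-resp-↭ τ s′ in U″ , s″ , ↭.trans ρ ρ′

  anySublist? : ∀ {P : List A → Set} → Decidable P → ∀ S → Dec (∃ λ U → U ⊆ S × P U)
  anySublist? P? [] = map′ (λ p → [] , [] , p) (λ where (_ , [] , p) → p) (P? [])
  anySublist? P? (x ∷ S) with anySublist? (P? ∘ (x ∷_)) S | anySublist? P? S
  ... | yes (U , s , p) | _               = yes (x ∷ U , ≡.refl ∷ s , p)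
  ... | no _            | yes (U , s , p) = yes (U , x ∷ʳ s , p)
  ... | no ¬with        | no ¬without     = no λ where
    (U , _ ∷ʳ s , p)          → ¬without (U , s , p)
    (_ ∷ U , ≡.refl ∷ s , p)  → ¬with (U , s , p)

  replicate-⊆ : ∀ {c q} (x : A) → c ℕ.≤ q → List.replicate c x ⊆ List.replicate q x
  replicate-⊆ x ℕ.z≤n       = minimum _
  replicate-⊆ x (ℕ.s≤s c≤q) = ≡.refl ∷ replicate-⊆ x c≤q

  replicate-+ : ∀ m k (x : A) → List.replicate (m ℕ.+ k) x ≡ List.replicate m x ++ List.replicate k x
  replicate-+ zero    k x = ≡.refl
  replicate-+ (suc m) k x = ≡.cong (x ∷_) (replicate-+ m k x)

  length-rep : ∀ j (T : List A) → List.length (rep j T) ≡ j ℕ.* List.length T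
  length-rep j []      = ≡.sym (ℕₚ.*-zeroʳ j)
  length-rep j (t ∷ T) = ≡.trans (Listₚ.length-++ (List.replicate j t))
    (≡.trans (≡.cong₂ ℕ._+_ (Listₚ.length-replicate j) (length-rep j T)) (≡.sym (ℕₚ.*-suc j (List.length T))))

separate-zeros : ∀ {m} (xs : List (Fin (suc m))) → ∃₂ λ c ys → xs ↭ List.replicate c zero ++ List.map suc ys
separate-zeros []           = 0 , [] , ↭.refl
separate-zeros (zero ∷ xs)  = let c , ys , σ = separate-zeros xs in suc c , ys , prep zero σ
separate-zeros (suc x ∷ xs) = let c , ys , σ = separate-zeros xs in
  c , x ∷ ys , ↭.trans (prep (suc x) σ) (↭-sym (Perm.shift (suc x) (List.replicate c zero) (List.map suc ys)))

-- The hypothesis says that no index occurs more than q times in xs.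
selection-⊆-rep : ∀ {A : Set} q (T : List A) (xs : List (Fin (List.length T))) →
                  (∀ i zs → ¬ (xs ↭ List.replicate (suc q) i ++ zs)) →
                  ∃ λ U → U ⊆ rep q T × List.map (List.lookup T) xs ↭ U
selection-⊆-rep q []      []      _    = [] , [] , ↭.refl
selection-⊆-rep q (t ∷ T) xs few with separate-zeros xs
-- The c occurrences of index zero are served by the block of q copies of t; the remaining indices
-- point into the tail.
... | c , ys , σ with selection-⊆-rep q T ys (λ i zs τ → few (suc i) (List.replicate c zero ++ List.map suc zs) (begin
        xs                                                                    ↭⟨ σ ⟩
        List.replicate c zero ++ List.map suc ys                              ↭⟨ Perm.++⁺ˡ _ (Perm.map⁺ suc τ) ⟩
        List.replicate c zero ++ List.map suc (List.replicate (suc q) i ++ zs)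
          ≡⟨ ≡.cong (List.replicate c zero ++_) (≡.trans (Listₚ.map-++ suc (List.replicate (suc q) i) zs)
                (≡.cong (_++ List.map suc zs) (Listₚ.map-replicate suc (suc q) i))) ⟩
        List.replicate c zero ++ List.replicate (suc q) (suc i) ++ List.map suc zs
          ↭⟨ Perm.shifts (List.replicate c zero) (List.replicate (suc q) (suc i)) ⟩
        List.replicate (suc q) (suc i) ++ List.replicate c zero ++ List.map suc zs ∎))
  where open PermutationReasoning
... | U , U⊆ , τ = List.replicate c t ++ U , ++⁺ (replicate-⊆ t c≤q) U⊆ , (begin
        List.map (List.lookup (t ∷ T)) xs
          ↭⟨ Perm.map⁺ _ σ ⟩
        List.map (List.lookup (t ∷ T)) (List.replicate c zero ++ List.map suc ys)
          ≡⟨ ≡.trans (Listₚ.map-++ _ (List.replicate c zero) _) (≡.cong₂ _++_ (Listₚ.map-replicate _ c zero) (≡.sym (Listₚ.map-∘ ys))) ⟩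
        List.replicate c t ++ List.map (List.lookup T) ys
          ↭⟨ Perm.++⁺ˡ _ τ ⟩
        List.replicate c t ++ U ∎)
  where
  open PermutationReasoning
  c≤q : c ℕ.≤ q
  c≤q = ℕₚ.≮⇒≥ λ q<c → few zero (List.replicate (c ℕ.∸ suc q) zero ++ List.map suc ys) (↭.trans σ (↭-reflexive
    (≡.trans (≡.cong (λ c → List.replicate c zero ++ List.map suc ys) (≡.sym (ℕₚ.m+[n∸m]≡n q<c)))
      (≡.trans (≡.cong (_++ List.map suc ys) (replicate-+ (suc q) (c ℕ.∸ suc q) zero))
         (Listₚ.++-assoc (List.replicate (suc q) zero) _ _)))))

ZeroSum-resp-↭ : ∀ {p n} {S S′ : Seq p n} → S ↭ S′ → ZeroSum S → ZeroSum S′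
ZeroSum-resp-↭ {p} σ zs i = ≡.trans (≡.cong (ℕ._% suc (p ℕ.∸ 1)) (sum-↭ (Perm.map⁺ _ (↭-sym σ)))) (zs i)

hasZSLen? : ∀ {p n} k (S : Seq p n) → Dec (HasZSLen k S)
hasZSLen? k S = anySublist? (λ U → (List.length U ℕₚ.≟ k) ×-dec all? (λ i → _ ℕₚ.≟ 0)) S

constant-of-no-zero-sum : ∀ {q n} {S T : Seq (suc q) n} → S ↭ rep q T → ¬ HasZSLen (suc q) S →
  ∀ x (xs : Vec (Fin (List.length T)) q) → ZeroSum (List.map (List.lookup T) (x ∷ Vec.toList xs)) → All (x ≡_) xs
constant-of-no-zero-sum {q} {n} {S} {T} σ none x xs zs with All.all? (x ≟_) xs
... | yes const = const
... | no ¬const = contradiction hasZS none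
  where
  ws = x ∷ Vec.toList xs
  length-ws : List.length ws ≡ suc q
  length-ws = ≡.cong suc (Vecₚ.length-toList xs)
  -- The tuple has exactly q + 1 entries, so q + 1 copies of i fill it: with nothing left over it is
  -- constant, and anything left over makes it too long.
  few : ∀ i zs → ¬ (ws ↭ List.replicate (suc q) i ++ zs)
  few i []       τ = ¬const (VAllₚ.toList⁻ (LAll.tail same))
    where
    same′ : LAll.All (i ≡_) ws
    same′ = Perm.All-resp-↭ (↭-sym τ) (LAllₚ.++⁺ (LAllₚ.replicate⁺ (suc q) ≡.refl) LAll.[])
    same : LAll.All (x ≡_) ws
    same = LAll.map (≡.trans (≡.sym (LAll.head same′))) same′
  few i (z ∷ zs) τ = ℕₚ.m≢1+m+n (suc q) (≡.trans (≡.sym length-ws) (≡.trans (Perm.↭-length τ)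
    (≡.trans (Listₚ.length-++ (List.replicate (suc q) i)) (≡.trans (≡.cong (ℕ._+ suc (List.length zs)) (Listₚ.length-replicate (suc q))) (ℕₚ.+-suc (suc q) _)))))
  hasZS : HasZSLen (suc q) S
  hasZS with selection-⊆-rep q T ws few
  ... | U , U⊆ , τ with ⊆-resp-↭ (↭-sym σ) U⊆
  ... | U′ , U′⊆ , τ′ = U′ , U′⊆
        , ≡.trans (≡.sym (Perm.↭-length (↭.trans τ τ′))) (≡.trans (Listₚ.length-map _ ws) length-ws)
        , ZeroSum-resp-↭ (↭.trans τ τ′) zs

-- The zero-sum tensor on the indices of T

module _ {k n} (prime-p : Prime (2 ℕ.+ k)) {S T : Seq (2 ℕ.+ k) n}
         (S↭ : S ↭ rep (1 ℕ.+ k) T) (none : ¬ HasZSLen (2 ℕ.+ k) S) where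

  private
    p = 2 ℕ.+ k
    X = Fin (List.length T)

  open ModPrime prime-p
  open DecIntegralDomain ℤ/p using () renaming (trans to ≈-trans)
  open SliceRank ℤ/p
  open Monomials ℤ/p

  coordinate : X → Fin n → ℤ
  coordinate x i = + toℕ (List.lookup T x i)

  zeroSumTensor : Tensor X p
  zeroSumTensor = detectors +_ coordinate (1 ℕ.+ k)

  coordinateSum : ∀ {j} → Vec X j → Fin n → ℕ
  coordinateSum xs i = ℕL.sum (List.map (λ a → toℕ (a i)) (List.map (List.lookup T) (Vec.toList xs)))

  slotSum≡coordinateSum : ∀ {j} (xs : Vec X j) i → slotSum (λ x → coordinate x i) xs ≡ + coordinateSum xs i
  slotSum≡coordinateSum []       i = ≡.refl
  slotSum≡coordinateSum (x ∷ xs) i = ≡.trans (≡.cong (λ z → coordinate x i ℤ.+ z) (slotSum≡coordinateSum xs i))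
    (≡.sym (ℤₚ.pos-+ (toℕ (List.lookup T x i)) _))

  slotSum-replicate : ∀ j x i → slotSum (λ x → coordinate x i) (replicate j x) ≡ + (j ℕ.* toℕ (List.lookup T x i))
  slotSum-replicate zero    x i = ≡.refl
  slotSum-replicate (suc j) x i = ≡.trans (≡.cong (λ z → coordinate x i ℤ.+ z) (slotSum-replicate j x i))
    (≡.sym (ℤₚ.pos-+ (toℕ (List.lookup T x i)) _))

  residue≈ : ∀ N → (+ (N ℕ.% p)) ≈ₚ (+ N)
  residue≈ N = congruent (divides (ℤ.- + (N ℕ./ p)) (begin
    + r ℤ.- + N                             ≡⟨ ≡.cong (λ z → + r ℤ.- + z) (m≡m%n+[m/n]*n N p) ⟩
    + r ℤ.- + (r ℕ.+ N ℕ./ p ℕ.* p)         ≡⟨ ≡.cong (λ z → + r ℤ.- z) (≡.trans (ℤₚ.pos-+ r _) (≡.cong (λ z → + r ℤ.+ z) (ℤₚ.pos-* (N ℕ./ p) p))) ⟩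
    + r ℤ.- (+ r ℤ.+ + (N ℕ./ p) ℤ.* + p)   ≡⟨ solve 3 (λ r q p → r :- (r :+ q :* p) := (:- q) :* p) ≡.refl (+ r) (+ (N ℕ./ p)) (+ p) ⟩
    ℤ.- + (N ℕ./ p) ℤ.* + p                 ∎))
    where
    r = N ℕ.% p
    open ≡.≡-Reasoning
    open ℤSolver.+-*-Solver

  zeroSumTensor-Diagonal : Diagonal zeroSumTensor
  zeroSumTensor-Diagonal = record { onDiagonal = onDiagonal ; offDiagonal = offDiagonal }
    where
    onDiagonal : ∀ x → ¬ (zeroSumTensor (replicate p x) ≈ₚ 0ℤ)
    -- On the diagonal each slot sum is p times a coordinate, hence zero modulo p, and no v from 1
    -- to p - 1 is.
    onDiagonal x = detectors-≉0 +_ λ i → detector-≉0 (λ x → coordinate x i) +_ (1 ℕ.+ k) {replicate p x} λ v 1≤v v≤d v≈ →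
      ℕₚ.<⇒≱ (ℕ.s≤s v≤d) (ℕ∣.∣⇒≤ {{ℕ.>-nonZero 1≤v}} (≈0⇒∣ (≈-trans v≈ (∣⇒≈0 (≡.subst (λ z → p ℕ∣.∣ ℤ.∣ z ∣)
        (≡.sym (slotSum-replicate p x i)) (ℕ∣.m∣m*n (toℕ (List.lookup T x i))))))))
    offDiagonal : ∀ x xs → ¬ All (x ≡_) xs → zeroSumTensor (x ∷ xs) ≈ₚ 0ℤ
    offDiagonal x xs ¬const with ¬∀⟶∃¬ n _ (λ i → coordinateSum (x ∷ xs) i ℕ.% p ℕₚ.≟ 0)
                                   (¬const ∘ constant-of-no-zero-sum {T = T} S↭ none x xs)
    -- The nonzero residue of the i-th coordinate sum is itself the v whose factor vanishes.
    ... | i , ≢0 = detectors-≈0 +_ {v = coordinate} {xs = x ∷ xs} i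
          (detector-≈0 (λ x → coordinate x i) +_ {xs = x ∷ xs} (ℕₚ.n≢0⇒n>0 ≢0) (ℕ.s≤s⁻¹ (m%n<n (coordinateSum (x ∷ xs) i) p))
            (≡.subst ((+ (coordinateSum (x ∷ xs) i ℕ.% p)) ≈ₚ_) (≡.sym (slotSum≡coordinateSum (x ∷ xs) i)) (residue≈ _)))

  slice-rank-bound : (L : List (Vec ℕ n)) →
                     (∀ {a} → All (ℕ._≤ 1 ℕ.+ k) a → p ℕ.* Vec.sum a ℕ.≤ n ℕ.* (1 ℕ.+ k) → a ∈ L) →
                     List.length T ℕ.≤ p ℕ.* List.length L
  slice-rank-bound L complete =
    diagonal-bound k (detectors-Sliced +_ coordinate (1 ℕ.+ k) L complete) zeroSumTensor-Diagonal

-- Partial sums of the exponential series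

module Exponential where
  open import Data.Rational using (_+_; _*_; _≤_; _/_; NonNegative)
  open ℚₚ.≤-Reasoning

  fromℕ : ℕ → ℚ
  fromℕ a = + a / 1

  private
    /-≃ : ∀ a d → ℚ.toℚᵘ (+ a / suc d) ℚᵘ.≃ ℚᵘ.mkℚᵘ (+ a) d
    /-≃ a d = ℚₚ.toℚᵘ-fromℚᵘ (ℚᵘ.mkℚᵘ (+ a) d)

  /-+ : ∀ a b d .{{_ : ℕ.NonZero d}} → + (a ℕ.+ b) / d ≡ + a / d + + b / d
  /-+ a b (suc d) = ℚₚ.toℚᵘ-injective (ℚᵘₚ.≃-trans (/-≃ (a ℕ.+ b) d) (ℚᵘₚ.≃-sym (ℚᵘₚ.≃-trans (ℚₚ.toℚᵘ-homo-+ (+ a / suc d) (+ b / suc d))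
    (ℚᵘₚ.≃-trans (ℚᵘₚ.+-cong (/-≃ a d) (/-≃ b d)) (ℚᵘ.*≡* (≡.trans
      (solve 3 (λ a b d → (a :* d :+ b :* d) :* d := (a :+ b) :* (d :* d)) ≡.refl (+ a) (+ b) (+ suc d))
      (≡.cong₂ ℤ._*_ (≡.sym (ℤₚ.pos-+ a b)) (≡.sym (ℤₚ.pos-* (suc d) (suc d))))))))))
    where open ℤSolver.+-*-Solver

  fromℕ-*-/ : ∀ a b d .{{_ : ℕ.NonZero d}} → + (a ℕ.* b) / d ≡ fromℕ a * (+ b / d)
  fromℕ-*-/ a b (suc d) = ℚₚ.toℚᵘ-injective (ℚᵘₚ.≃-trans (/-≃ (a ℕ.* b) d) (ℚᵘₚ.≃-sym (ℚᵘₚ.≃-trans (ℚₚ.toℚᵘ-homo-* (fromℕ a) (+ b / suc d))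
    (ℚᵘₚ.≃-trans (ℚᵘₚ.*-cong (/-≃ a 0) (/-≃ b d)) (ℚᵘ.*≡* (≡.cong₂ ℤ._*_ (≡.sym (ℤₚ.pos-* a b)) (≡.cong +_ (≡.sym (ℕₚ.*-identityˡ (suc d))))))))))

  /-cancel : ∀ a d .{{_ : ℕ.NonZero d}} → fromℕ d * (+ a / d) ≡ fromℕ a
  /-cancel a (suc d) = ≡.trans (≡.sym (fromℕ-*-/ (suc d) a (suc d))) (ℚₚ.toℚᵘ-injective (ℚᵘₚ.≃-trans (/-≃ (suc d ℕ.* a) d)
    (ℚᵘₚ.≃-sym (ℚᵘₚ.≃-trans (/-≃ a 0) (ℚᵘ.*≡* (≡.trans (≡.sym (ℤₚ.pos-* a (suc d)))
      (≡.trans (≡.cong +_ (ℕₚ.*-comm a (suc d))) (≡.sym (ℤₚ.*-identityʳ _)))))))))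

  fromℕ-mono : ∀ {a b} → a ℕ.≤ b → fromℕ a ≤ fromℕ b
  fromℕ-mono {a} {b} a≤b = ℚₚ.toℚᵘ-cancel-≤ (ℚᵘₚ.≤-respˡ-≃ (ℚᵘₚ.≃-sym (/-≃ a 0)) (ℚᵘₚ.≤-respʳ-≃ (ℚᵘₚ.≃-sym (/-≃ b 0))
    (ℚᵘ.*≤* (ℤₚ.*-monoʳ-≤-nonNeg (+ 1) (ℤ.+≤+ a≤b)))))

  /-nonNeg : ∀ a d .{{_ : ℕ.NonZero d}} → NonNegative (+ a / d)
  /-nonNeg a d = ℚₚ.normalize-nonNeg a d

  *-nonNeg : ∀ x y → NonNegative x → NonNegative y → NonNegative (x * y)
  *-nonNeg x y x≥0 y≥0 = ℚₚ.nonNeg*nonNeg⇒nonNeg x {{x≥0}} y {{y≥0}}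

  +-nonNeg : ∀ x y → NonNegative x → NonNegative y → NonNegative (x + y)
  +-nonNeg x y x≥0 y≥0 = ℚₚ.nonNeg+nonNeg⇒nonNeg x {{x≥0}} y {{y≥0}}

  x≤x+y : ∀ x y → NonNegative y → x ≤ x + y
  x≤x+y x y y≥0 = ≡.subst (_≤ x + y) (ℚₚ.+-identityʳ x) (ℚₚ.+-monoʳ-≤ x (ℚₚ.nonNegative⁻¹ y {{y≥0}}))

  expTerm-nonNeg : ∀ x → NonNegative x → ∀ j → NonNegative (expTerm x j)
  expTerm-nonNeg x x≥0 zero    = _
  expTerm-nonNeg x x≥0 (suc j) = *-nonNeg (expTerm x j * x) (+ 1 / suc j) (*-nonNeg (expTerm x j) x (expTerm-nonNeg x x≥0 j) x≥0) (/-nonNeg 1 (suc j))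

  module _ (x ξ : ℚ) (x≥0 : NonNegative x) (ξ≥0 : NonNegative ξ) where
    open ℚSolver.+-*-Solver

    private
      z = x + ξ
      z≥0 : NonNegative z
      z≥0 = +-nonNeg x ξ x≥0 ξ≥0

    -- The mean value inequality zʲ⁺¹ − xʲ⁺¹ ≤ (j + 1)(z − x)zʲ, divided by (j + 1)!.
    expTerm-increment : ∀ j → expTerm z (suc j) ≤ expTerm x (suc j) + ξ * expTerm z j
    expTerm-increment zero = ℚₚ.≤-reflexive
      (solve 2 (λ x ξ → con 1ℚ :* (x :+ ξ) :* con 1ℚ := con 1ℚ :* x :* con 1ℚ :+ ξ :* con 1ℚ) ≡.refl x ξ)
    expTerm-increment (suc j) = begin
      t₁ * (x + ξ) * c
        ≡⟨ solve 4 (λ t x ξ c → t :* (x :+ ξ) :* c := t :* (x :* c) :+ ξ :* c :* t) ≡.refl t₁ x ξ c ⟩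
      t₁ * (x * c) + ξ * c * t₁
        ≤⟨ ℚₚ.+-monoˡ-≤ (ξ * c * t₁) (ℚₚ.*-monoʳ-≤-nonNeg (x * c) {{*-nonNeg x c x≥0 c≥0}} (expTerm-increment j)) ⟩
      (s₁ + ξ * t₀) * (x * c) + ξ * c * t₁
        ≡⟨ solve 6 (λ s x c ξ t₀ t₁ → (s :+ ξ :* t₀) :* (x :* c) :+ ξ :* c :* t₁ := s :* x :* c :+ ξ :* c :* (t₀ :* x :+ t₁)) ≡.refl s₁ x c ξ t₀ t₁ ⟩
      s₁ * x * c + ξ * c * (t₀ * x + t₁)
        ≤⟨ ℚₚ.+-monoʳ-≤ (s₁ * x * c) (ℚₚ.*-monoˡ-≤-nonNeg (ξ * c) {{*-nonNeg ξ c ξ≥0 c≥0}}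
             (ℚₚ.+-monoˡ-≤ t₁ (ℚₚ.*-monoˡ-≤-nonNeg t₀ {{expTerm-nonNeg z z≥0 j}} (x≤x+y x ξ ξ≥0)))) ⟩
      s₁ * x * c + ξ * c * (t₀ * z + t₁)
        ≡⟨ ≡.cong (λ w → s₁ * x * c + ξ * c * (w + t₁)) t₀z ⟩
      s₁ * x * c + ξ * c * (fromℕ (suc j) * t₁ + t₁)
        ≡⟨ ≡.cong (λ w → s₁ * x * c + w) (solve 4 (λ ξ c m t → ξ :* c :* (m :* t :+ t) := ((con 1ℚ :+ m) :* c) :* (ξ :* t)) ≡.refl ξ c (fromℕ (suc j)) t₁) ⟩
      s₁ * x * c + ((1ℚ + fromℕ (suc j)) * c) * (ξ * t₁)
        ≡⟨ ≡.cong (λ w → s₁ * x * c + w * (ξ * t₁)) (≡.trans (≡.cong (_* c) (≡.sym (/-+ 1 (suc j) 1))) (/-cancel 1 (suc (suc j)))) ⟩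
      s₁ * x * c + 1ℚ * (ξ * t₁)
        ≡⟨ ≡.cong (λ w → s₁ * x * c + w) (ℚₚ.*-identityˡ (ξ * t₁)) ⟩
      s₁ * x * c + ξ * t₁ ∎
      where
      t₀ = expTerm z j
      t₁ = expTerm z (suc j)
      s₁ = expTerm x (suc j)
      c  = + 1 / suc (suc j)
      c≥0 : NonNegative c
      c≥0 = /-nonNeg 1 (suc (suc j))
      t₀z : t₀ * z ≡ fromℕ (suc j) * t₁
      t₀z = begin-equality
        t₀ * z                                     ≡⟨ ℚₚ.*-identityˡ (t₀ * z) ⟨
        1ℚ * (t₀ * z)                              ≡⟨ ≡.cong (_* (t₀ * z)) (/-cancel 1 (suc j)) ⟨
        (fromℕ (suc j) * (+ 1 / suc j)) * (t₀ * z) ≡⟨ solve 3 (λ m c t → (m :* c) :* t := m :* (t :* c)) ≡.refl (fromℕ (suc j)) (+ 1 / suc j) (t₀ * z) ⟩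
        fromℕ (suc j) * t₁                         ∎

    -- The inequality between terms, summed. The last partial sum stops one term earlier because
    -- differentiating a truncated exponential series drops its top term.
    expPartial-increment : ∀ k → expPartial z (suc k) ≤ expPartial x (suc k) + ξ * expPartial z k
    expPartial-increment zero = ℚₚ.≤-trans (ℚₚ.+-monoʳ-≤ 1ℚ (expTerm-increment 0))
      (ℚₚ.≤-reflexive (≡.sym (ℚₚ.+-assoc 1ℚ (expTerm x 1) (ξ * 1ℚ))))
    expPartial-increment (suc k) = begin
      expPartial z (suc k) + expTerm z (suc (suc k))
        ≤⟨ ℚₚ.+-mono-≤ (expPartial-increment k) (expTerm-increment (suc k)) ⟩
      (expPartial x (suc k) + ξ * expPartial z k) + (expTerm x (suc (suc k)) + ξ * expTerm z (suc k))
        ≡⟨ solve 5 (λ a ξ b c d → (a :+ ξ :* b) :+ (c :+ ξ :* d) := (a :+ c) :+ ξ :* (b :+ d)) ≡.refl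
             (expPartial x (suc k)) ξ (expPartial z k) (expTerm x (suc (suc k))) (expTerm z (suc k)) ⟩
      expPartial x (suc (suc k)) + ξ * expPartial z (suc k) ∎

    -- Truncated form of (1 - ξ) exp(x + ξ) ≤ exp x. Iterating it n times from 0 bounds (1 - ξ)ⁿ
    -- exp(nξ) by 1.
    expPartial-shift : ∀ k → expPartial z k ≤ expPartial x k + ξ * expPartial z k
    expPartial-shift zero    = x≤x+y 1ℚ (ξ * 1ℚ) (*-nonNeg ξ 1ℚ ξ≥0 _)
    expPartial-shift (suc k) = ℚₚ.≤-trans (expPartial-increment k)
      (ℚₚ.+-monoʳ-≤ (expPartial x (suc k)) (ℚₚ.*-monoˡ-≤-nonNeg ξ {{ξ≥0}} (x≤x+y (expPartial z k) (expTerm z (suc k)) (expTerm-nonNeg z z≥0 (suc k)))))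

  expPartial-0 : ∀ k → expPartial 0ℚ k ≡ 1ℚ
  expPartial-0 zero    = ≡.refl
  expPartial-0 (suc k) = ≡.trans (≡.cong₂ _+_ (expPartial-0 k)
    (≡.trans (≡.cong (_* (+ 1 / suc k)) (ℚₚ.*-zeroʳ (expTerm 0ℚ k))) (ℚₚ.*-zeroˡ (+ 1 / suc k)))) (ℚₚ.+-identityʳ 1ℚ)

  -- (1 − a / b)ⁿ · exp(n a / b) ≤ 1 with denominators cleared.
  pow-*-exp≤ : ∀ a g b .{{_ : ℕ.NonZero b}} → g ℕ.+ a ≡ b → ∀ n k →
               fromℕ (g ℕ.^ n) * expPartial (+ (a ℕ.* n) / b) k ≤ fromℕ (b ℕ.^ n)
  pow-*-exp≤ a g b g+a≡b zero k = ℚₚ.≤-reflexive (≡.trans (ℚₚ.*-identityˡ _)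
    (≡.trans (≡.cong (λ x → expPartial x k) (≡.trans (ℚₚ./-cong {+ (a ℕ.* 0)} {b} {+ 0} {b} (≡.cong +_ (ℕₚ.*-zeroʳ a)) ≡.refl) (ℚₚ.0/n≡0 b))) (expPartial-0 k)))
  pow-*-exp≤ a g b g+a≡b (suc n) k = begin
    fromℕ (g ℕ.* g ℕ.^ n) * expPartial (+ (a ℕ.* suc n) / b) k
      ≡⟨ ≡.cong₂ (λ u v → u * expPartial v k) (fromℕ-*-/ g (g ℕ.^ n) 1)
           (≡.trans (ℚₚ./-cong {+ (a ℕ.* suc n)} {b} {+ (a ℕ.* n ℕ.+ a)} {b} (≡.cong +_ (≡.trans (ℕₚ.*-suc a n) (ℕₚ.+-comm a (a ℕ.* n)))) ≡.refl) (/-+ (a ℕ.* n) a b)) ⟩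
    (fromℕ g * fromℕ (g ℕ.^ n)) * Ez
      ≡⟨ solve 3 (λ g h e → (g :* h) :* e := h :* (g :* e)) ≡.refl (fromℕ g) (fromℕ (g ℕ.^ n)) Ez ⟩
    fromℕ (g ℕ.^ n) * (fromℕ g * Ez)
      ≤⟨ ℚₚ.*-monoˡ-≤-nonNeg (fromℕ (g ℕ.^ n)) {{/-nonNeg (g ℕ.^ n) 1}} shift ⟩
    fromℕ (g ℕ.^ n) * (fromℕ b * Ex)
      ≡⟨ solve 3 (λ g h e → h :* (g :* e) := g :* (h :* e)) ≡.refl (fromℕ b) (fromℕ (g ℕ.^ n)) Ex ⟩
    fromℕ b * (fromℕ (g ℕ.^ n) * Ex)
      ≤⟨ ℚₚ.*-monoˡ-≤-nonNeg (fromℕ b) {{/-nonNeg b 1}} (pow-*-exp≤ a g b g+a≡b n k) ⟩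
    fromℕ b * fromℕ (b ℕ.^ n)
      ≡⟨ fromℕ-*-/ b (b ℕ.^ n) 1 ⟨
    fromℕ (b ℕ.* b ℕ.^ n) ∎
    where
    open ℚSolver.+-*-Solver
    x = + (a ℕ.* n) / b
    ξ = + a / b
    Ex = expPartial x k
    Ez = expPartial (x + ξ) k
    shift : fromℕ g * Ez ≤ fromℕ b * Ex
    shift = +-cancelʳ (fromℕ a * Ez) (begin
      fromℕ g * Ez + fromℕ a * Ez
        ≡⟨ ℚₚ.*-distribʳ-+ Ez (fromℕ g) (fromℕ a) ⟨
      (fromℕ g + fromℕ a) * Ez
        ≡⟨ ≡.cong (_* Ez) (≡.trans (≡.sym (/-+ g a 1)) (≡.cong fromℕ g+a≡b)) ⟩
      fromℕ b * Ez
        ≤⟨ ℚₚ.*-monoˡ-≤-nonNeg (fromℕ b) {{/-nonNeg b 1}} (expPartial-shift x ξ (/-nonNeg (a ℕ.* n) b) (/-nonNeg a b) k) ⟩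
      fromℕ b * (Ex + ξ * Ez)
        ≡⟨ solve 4 (λ b e ξ f → b :* (e :+ ξ :* f) := b :* e :+ (b :* ξ) :* f) ≡.refl (fromℕ b) Ex ξ Ez ⟩
      fromℕ b * Ex + (fromℕ b * ξ) * Ez
        ≡⟨ ≡.cong (λ w → fromℕ b * Ex + w * Ez) (/-cancel a b) ⟩
      fromℕ b * Ex + fromℕ a * Ez ∎)
      where
      +-cancelʳ : ∀ w {u v} → u + w ≤ v + w → u ≤ v
      +-cancelʳ w {u} {v} le = begin
        u                 ≡⟨ solve 2 (λ u w → u := u :+ w :+ :- w) ≡.refl u w ⟩
        u + w + ℚ.- w     ≤⟨ ℚₚ.+-monoˡ-≤ (ℚ.- w) le ⟩
        v + w + ℚ.- w     ≡⟨ solve 2 (λ u w → u := u :+ w :+ :- w) ≡.refl v w ⟨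
        v                 ∎

  -- This removes the exponential: every partial sum at n a / b is at most (b / g)ⁿ, so a comparison
  -- of natural numbers suffices.
  MulExpLe-/ : ∀ a g b .{{_ : ℕ.NonZero b}} .{{_ : ℕ.NonZero g}} → g ℕ.+ a ≡ b → ∀ n N M →
               N ℕ.* b ℕ.^ n ℕ.≤ M ℕ.* g ℕ.^ n → MulExpLe N (+ (a ℕ.* n) / b) M
  MulExpLe-/ a g b g+a≡b n N M le k =
    ℚₚ.*-cancelˡ-≤-pos (fromℕ (g ℕ.^ n)) {{ℚₚ.normalize-pos (g ℕ.^ n) 1 {{_}} {{ℕₚ.m^n≢0 g n}}}} (begin
    fromℕ (g ℕ.^ n) * (fromℕ N * E)
      ≡⟨ solve 3 (λ g n e → g :* (n :* e) := n :* (g :* e)) ≡.refl (fromℕ (g ℕ.^ n)) (fromℕ N) E ⟩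
    fromℕ N * (fromℕ (g ℕ.^ n) * E)
      ≤⟨ ℚₚ.*-monoˡ-≤-nonNeg (fromℕ N) {{/-nonNeg N 1}} (pow-*-exp≤ a g b g+a≡b n k) ⟩
    fromℕ N * fromℕ (b ℕ.^ n)
      ≡⟨ fromℕ-*-/ N (b ℕ.^ n) 1 ⟨
    fromℕ (N ℕ.* b ℕ.^ n)
      ≤⟨ fromℕ-mono le ⟩
    fromℕ (M ℕ.* g ℕ.^ n)
      ≡⟨ fromℕ-*-/ M (g ℕ.^ n) 1 ⟩
    fromℕ M * fromℕ (g ℕ.^ n)
      ≡⟨ ℚₚ.*-comm (fromℕ M) (fromℕ (g ℕ.^ n)) ⟩
    fromℕ (g ℕ.^ n) * fromℕ M ∎)
    where
    open ℚSolver.+-*-Solver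
    E = expPartial (+ (a ℕ.* n) / b) k

-- Counting monomials of low degree

open import Data.Nat using (_+_; _∸_; _^_; _*_; _≤_; _≤?_; _≥_; _>_)
open ℕₚ.≤-Reasoning

boundedVecs : ℕ → ∀ n → List (Vec ℕ n)
boundedVecs q zero    = [] ∷ []
boundedVecs q (suc n) = cartesianProductWith _∷_ (upTo (suc q)) (boundedVecs q n)

∈-boundedVecs : ∀ {q n} {a : Vec ℕ n} → All (_≤ q) a → a ∈ boundedVecs q n
∈-boundedVecs []         = here ≡.refl
∈-boundedVecs (i≤q ∷ as) = ∈-cartesianProductWith⁺ _∷_ (∈-upTo⁺ (ℕ.s≤s i≤q)) (∈-boundedVecs as)

module _ (u : ℕ → ℕ) where

  weight : ∀ {n} → Vec ℕ n → ℕ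
  weight []      = 1
  weight (i ∷ a) = u i * weight a

  sum-weight-∷ : ∀ {n} i (L : List (Vec ℕ n)) →
                 ℕL.sum (List.map weight (List.map (i ∷_) L)) ≡ u i * ℕL.sum (List.map weight L)
  sum-weight-∷ i []      = ≡.sym (ℕₚ.*-zeroʳ (u i))
  sum-weight-∷ i (a ∷ L) = ≡.trans (≡.cong (λ x → u i * weight a + x) (sum-weight-∷ i L)) (≡.sym (ℕₚ.*-distribˡ-+ (u i) (weight a) _))

  sum-weight-product : ∀ {n} is (L : List (Vec ℕ n)) →
    ℕL.sum (List.map weight (cartesianProductWith _∷_ is L)) ≡ ℕL.sum (List.map u is) * ℕL.sum (List.map weight L)
  sum-weight-product []       L = ≡.refl
  sum-weight-product (i ∷ is) L = begin-equality
    ℕL.sum (List.map weight (List.map (i ∷_) L ++ cartesianProductWith _∷_ is L))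
      ≡⟨ ≡.cong ℕL.sum (Listₚ.map-++ weight (List.map (i ∷_) L) _) ⟩
    ℕL.sum (List.map weight (List.map (i ∷_) L) ++ List.map weight (cartesianProductWith _∷_ is L))
      ≡⟨ sum-++ (List.map weight (List.map (i ∷_) L)) _ ⟩
    ℕL.sum (List.map weight (List.map (i ∷_) L)) + ℕL.sum (List.map weight (cartesianProductWith _∷_ is L))
      ≡⟨ ≡.cong₂ _+_ (sum-weight-∷ i L) (sum-weight-product is L) ⟩
    u i * ℕL.sum (List.map weight L) + ℕL.sum (List.map u is) * ℕL.sum (List.map weight L)
      ≡⟨ ℕₚ.*-distribʳ-+ (ℕL.sum (List.map weight L)) (u i) _ ⟨
    (u i + ℕL.sum (List.map u is)) * ℕL.sum (List.map weight L) ∎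

  -- The weight is multiplicative over coordinates, so its sum over a box factors.
  sum-weight-boundedVecs : ∀ q n → ℕL.sum (List.map weight (boundedVecs q n)) ≡ ℕL.sum (List.map u (upTo (suc q))) ^ n
  sum-weight-boundedVecs q zero    = ≡.refl
  sum-weight-boundedVecs q (suc n) = ≡.trans (sum-weight-product (upTo (suc q)) (boundedVecs q n))
    (≡.cong (ℕL.sum (List.map u (upTo (suc q))) *_) (sum-weight-boundedVecs q n))

markov : ∀ {A : Set} {P : A → Set} (P? : Decidable P) (w : A → ℕ) K → (∀ {a} → P a → K ≤ w a) →
         ∀ L → List.length (filter P? L) * K ≤ ℕL.sum (List.map w L)
markov P? w K K≤w [] = ℕ.z≤n
markov P? w K K≤w (a ∷ L) with P? a
... | yes pa = ℕₚ.+-mono-≤ (K≤w pa) (markov P? w K K≤w L)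
... | no  _  = ℕₚ.≤-trans (markov P? w K K≤w L) (ℕₚ.m≤n+m _ (w a))

-- Chernoff's method with weight (h / g) ^ (t i) for the exponent i, scaled by g ^ (e + d) to be an integer.
module _ (g h t e d : ℕ) {{_ : ℕ.NonZero g}} {{_ : ℕ.NonZero h}} (h≤g : h ≤ g) where

  chernoff : ℕ → ℕ
  chernoff i = g ^ ((e + d) ∸ t * i) * h ^ (t * i)

  -- With κ = g^e h^d this says `chernoff i` / κ ≥ (h / g)^(t i - d), cleared of denominators. It is
  -- an equality while t i ≤ e + d; past that, truncated subtraction only enlarges the weight.
  chernoff-entry : ∀ i → (g ^ e * h ^ d) * (g ^ d * h ^ (t * i)) ≤ chernoff i * (g ^ (t * i) * h ^ d)
  chernoff-entry i = begin
    (g ^ e * h ^ d) * (g ^ d * h ^ (t * i))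
      ≡⟨ solve 4 (λ a b c d → (a :* b) :* (c :* d) := (a :* c) :* (b :* d)) ≡.refl (g ^ e) (h ^ d) (g ^ d) (h ^ (t * i)) ⟩
    (g ^ e * g ^ d) * (h ^ d * h ^ (t * i))
      ≡⟨ ≡.cong (_* (h ^ d * h ^ (t * i))) (ℕₚ.^-distribˡ-+-* g e d) ⟨
    g ^ (e + d) * (h ^ d * h ^ (t * i))
      ≤⟨ ℕₚ.*-monoˡ-≤ (h ^ d * h ^ (t * i)) (ℕₚ.^-monoʳ-≤ g (ℕₚ.≤-trans (ℕₚ.m≤n+m∸n (e + d) (t * i)) (ℕₚ.≤-reflexive (ℕₚ.+-comm (t * i) _)))) ⟩
    g ^ ((e + d) ∸ t * i + t * i) * (h ^ d * h ^ (t * i))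
      ≡⟨ ≡.cong (_* (h ^ d * h ^ (t * i))) (ℕₚ.^-distribˡ-+-* g ((e + d) ∸ t * i) (t * i)) ⟩
    (g ^ ((e + d) ∸ t * i) * g ^ (t * i)) * (h ^ d * h ^ (t * i))
      ≡⟨ solve 4 (λ a b c d → (a :* b) :* (c :* d) := (a :* d) :* (b :* c)) ≡.refl (g ^ ((e + d) ∸ t * i)) (g ^ (t * i)) (h ^ d) (h ^ (t * i)) ⟩
    chernoff i * (g ^ (t * i) * h ^ d) ∎
    where open +-*-Solver

  chernoff-vec : ∀ {n} (a : Vec ℕ n) →
    (g ^ e * h ^ d) ^ n * (g ^ (n * d) * h ^ (t * Vec.sum a)) ≤ weight chernoff a * (g ^ (t * Vec.sum a) * h ^ (n * d))
  chernoff-vec [] rewrite ℕₚ.*-zeroʳ t = ℕₚ.≤-refl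
  chernoff-vec {suc n} (i ∷ a) = begin
    κ * κ ^ n * (g ^ (d + n * d) * h ^ (t * (i + Vec.sum a)))
      ≡⟨ ≡.cong₂ (λ x y → κ * κ ^ n * (x * y)) (ℕₚ.^-distribˡ-+-* g d (n * d)) (split h) ⟩
    κ * κ ^ n * ((g ^ d * g ^ (n * d)) * (h ^ (t * i) * h ^ (t * Vec.sum a)))
      ≡⟨ regroup κ (κ ^ n) (g ^ d) (g ^ (n * d)) (h ^ (t * i)) (h ^ (t * Vec.sum a)) ⟩
    (κ * (g ^ d * h ^ (t * i))) * (κ ^ n * (g ^ (n * d) * h ^ (t * Vec.sum a)))
      ≤⟨ ℕₚ.*-mono-≤ (chernoff-entry i) (chernoff-vec a) ⟩
    (chernoff i * (g ^ (t * i) * h ^ d)) * (weight chernoff a * (g ^ (t * Vec.sum a) * h ^ (n * d)))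
      ≡⟨ regroup (chernoff i) (weight chernoff a) (g ^ (t * i)) (g ^ (t * Vec.sum a)) (h ^ d) (h ^ (n * d)) ⟨
    chernoff i * weight chernoff a * ((g ^ (t * i) * g ^ (t * Vec.sum a)) * (h ^ d * h ^ (n * d)))
      ≡⟨ ≡.cong₂ (λ x y → chernoff i * weight chernoff a * (x * y)) (split g) (ℕₚ.^-distribˡ-+-* h d (n * d)) ⟨
    chernoff i * weight chernoff a * (g ^ (t * (i + Vec.sum a)) * h ^ (d + n * d)) ∎
    where
    κ = g ^ e * h ^ d
    split : ∀ b → b ^ (t * (i + Vec.sum a)) ≡ b ^ (t * i) * b ^ (t * Vec.sum a)
    split b = ≡.trans (≡.cong (b ^_) (ℕₚ.*-distribˡ-+ t i (Vec.sum a))) (ℕₚ.^-distribˡ-+-* b (t * i) (t * Vec.sum a))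
    regroup : ∀ a b c d x y → a * b * ((c * d) * (x * y)) ≡ (a * (c * x)) * (b * (d * y))
    regroup = solve 6 (λ a b c d x y → a :* b :* ((c :* d) :* (x :* y)) := (a :* (c :* x)) :* (b :* (d :* y))) ≡.refl
      where open +-*-Solver

  -- Relative to κⁿ the weight is at least h / g to the power t · sum - n d; the exponent is at most
  -- 0 and the base at most 1.
  chernoff-weight : ∀ {n} (a : Vec ℕ n) → t * Vec.sum a ≤ n * d → (g ^ e * h ^ d) ^ n ≤ weight chernoff a
  chernoff-weight {n} a small = ℕₚ.*-cancelʳ-≤ _ _ (g ^ (n * d) * h ^ s) {{nz}} (begin
    κ ^ n * (g ^ (n * d) * h ^ s)
      ≤⟨ chernoff-vec a ⟩
    weight chernoff a * (g ^ s * h ^ (n * d))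
      ≡⟨ ≡.cong (λ x → weight chernoff a * (g ^ s * x)) (pow h) ⟩
    weight chernoff a * (g ^ s * (h ^ s * h ^ r))
      ≤⟨ ℕₚ.*-monoʳ-≤ (weight chernoff a) (ℕₚ.*-monoʳ-≤ (g ^ s) (ℕₚ.*-monoʳ-≤ (h ^ s) (ℕₚ.^-monoˡ-≤ r h≤g))) ⟩
    weight chernoff a * (g ^ s * (h ^ s * g ^ r))
      ≡⟨ ≡.cong (weight chernoff a *_) (solve 3 (λ a b c → a :* (b :* c) := (a :* c) :* b) ≡.refl (g ^ s) (h ^ s) (g ^ r)) ⟩
    weight chernoff a * ((g ^ s * g ^ r) * h ^ s)
      ≡⟨ ≡.cong (λ x → weight chernoff a * (x * h ^ s)) (pow g) ⟨
    weight chernoff a * (g ^ (n * d) * h ^ s) ∎)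
    where
    open +-*-Solver
    κ = g ^ e * h ^ d
    s = t * Vec.sum a
    r = n * d ∸ s
    pow : ∀ b → b ^ (n * d) ≡ b ^ s * b ^ r
    pow b = ≡.trans (≡.cong (b ^_) (≡.sym (ℕₚ.m+[n∸m]≡n small))) (ℕₚ.^-distribˡ-+-* b s r)
    nz : ℕ.NonZero (g ^ (n * d) * h ^ s)
    nz = ℕₚ.m*n≢0 _ _ {{ℕₚ.m^n≢0 g (n * d)}} {{ℕₚ.m^n≢0 h s}}

  chernoff-count : ∀ q n {P : Vec ℕ n → Set} (P? : Decidable P) → (∀ a → P a → t * Vec.sum a ≤ n * d) →
    List.length (filter P? (boundedVecs q n)) * (g ^ e * h ^ d) ^ n ≤ ℕL.sum (List.map chernoff (upTo (suc q))) ^ n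
  chernoff-count q n P? P⇒ = ℕₚ.≤-trans
    (markov P? (weight chernoff) _ (λ {a} pa → chernoff-weight a (P⇒ a pa)) (boundedVecs q n))
    (ℕₚ.≤-reflexive (sum-weight-boundedVecs chernoff q n))

module _ (p n : ℕ) where

  LowDegree : Vec ℕ n → Set
  LowDegree a = p * Vec.sum a ≤ n * (p ∸ 1)

  lowDegree? : Decidable LowDegree
  lowDegree? a = p * Vec.sum a ≤? n * (p ∸ 1)

  lowDegreeVecs : List (Vec ℕ n)
  lowDegreeVecs = filter lowDegree? (boundedVecs (p ∸ 1) n)

^-distribʳ-* : ∀ n x y → (x * y) ^ n ≡ x ^ n * y ^ n
^-distribʳ-* zero    x y = ≡.refl
^-distribʳ-* (suc n) x y = ≡.trans (≡.cong (x * y *_) (^-distribʳ-* n x y))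
  (solve 4 (λ x y a b → x :* y :* (a :* b) := (x :* a) :* (y :* b)) ≡.refl x y (x ^ n) (y ^ n))
  where open +-*-Solver

-- Reduces the count to one coordinate: W / κ need only be at most y / x.
^-ratio : ∀ n D κ W x y .{{_ : ℕ.NonZero κ}} → D * κ ^ n ≤ W ^ n → W * x ≤ κ * y → D * x ^ n ≤ y ^ n
^-ratio n D κ W x y count ratio = ℕₚ.*-cancelˡ-≤ (κ ^ n) {{ℕₚ.m^n≢0 κ n}} (begin
  κ ^ n * (D * x ^ n)   ≡⟨ solve 3 (λ a b c → a :* (b :* c) := (b :* a) :* c) ≡.refl (κ ^ n) D (x ^ n) ⟩
  (D * κ ^ n) * x ^ n   ≤⟨ ℕₚ.*-monoˡ-≤ (x ^ n) count ⟩
  W ^ n * x ^ n         ≡⟨ ^-distribʳ-* n W x ⟨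
  (W * x) ^ n           ≤⟨ ℕₚ.^-monoˡ-≤ n ratio ⟩
  (κ * y) ^ n           ≡⟨ ^-distribʳ-* n κ y ⟩
  κ ^ n * y ^ n         ∎)
  where open +-*-Solver

geometric : ∀ N {f : ℕ → ℕ} → (∀ i → f i ≡ 2 ^ (N ∸ i)) → suc (ℕL.sum (List.applyUpTo f (suc N))) ≤ 2 ^ suc N
geometric zero    {f} f≡ rewrite f≡ 0 = ℕₚ.≤-refl
geometric (suc N) {f} f≡ = begin
  suc (f 0 + rest)        ≡⟨ ℕₚ.+-suc (f 0) rest ⟨
  f 0 + suc rest          ≤⟨ ℕₚ.+-mono-≤ (ℕₚ.≤-reflexive (f≡ 0)) (geometric N (f≡ ∘ suc)) ⟩
  2 ^ suc N + 2 ^ suc N   ≡⟨ ≡.cong (λ x → 2 ^ suc N + x) (ℕₚ.+-identityʳ _) ⟨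
  2 ^ suc (suc N)         ∎
  where rest = ℕL.sum (List.applyUpTo (f ∘ suc) (suc N))

-- γ = 2p² − (p − 2)² for p = 2 + j.
γ : ℕ → ℕ
γ j = j * j + 8 * j + 8

-- Per coordinate the target is p(1 - x) = pγ / 2p². Base 2 with the cruder degree bound n costs
-- less than 4, and 4 ≤ p(1 - x) amounts to p² - 4p - 4 ≥ 0, true from p = 5 on. For p = 3 the exact
-- bound 2n/3 is used; it calls for a cube root of the base, hence (5/4)³, a rational cube close to
-- 2.
lowDegreeVecs-count : ∀ j n → Prime (2 + j) → 1 ≤ j →
  List.length (lowDegreeVecs (2 + j) n) * (2 * (2 + j) ^ 2) ^ n ≤ ((2 + j) * γ j) ^ n
-- For p = 3: 10000 = 5⁴4², 27721 = 5⁶ + 5³4³ + 4⁶, and 27721 · 18 ≤ 10000 · 51.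
lowDegreeVecs-count 1 n _ _ = ^-ratio n (List.length (lowDegreeVecs 3 n)) 10000 27721 18 51
  (chernoff-count 5 4 3 4 2 (ℕₚ.n≤1+n 4) 2 n (lowDegree? 3 n) λ _ → id) (ℕₚ.≤ᵇ⇒≤ _ _ _)
-- At p = 4 the base 2 estimate would be too weak: 15/4 exceeds p(1 - x) = 7/2.
lowDegreeVecs-count 2 n prime-4 _ = contradiction prime-4 (from-no (prime? 4))
-- Here e + d = p - 1 is the largest exponent, so the weights are the powers of 2 from 2^(p - 1)
-- down to 1. Their sum is below 2^p, against κ = 2^(p - 2).
lowDegreeVecs-count (suc (suc (suc m))) n _ _ = ^-ratio n (List.length (lowDegreeVecs p n)) (2 ^ (3 + m) * 1) W (2 * p ^ 2) (p * γ (3 + m)) {{ℕₚ.m*n≢0 _ 1 {{ℕₚ.m^n≢0 2 (3 + m)}}}}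
  (chernoff-count 2 1 1 (3 + m) 1 (ℕ.s≤s ℕ.z≤n) (4 + m) n (lowDegree? (5 + m) n) sum≤n) (begin
  W * (2 * p ^ 2)               ≤⟨ ℕₚ.*-monoˡ-≤ (2 * p ^ 2) W≤ ⟩
  2 ^ (5 + m) * (2 * p ^ 2)     ≡⟨ solve 2 (λ z p → (con 2 :* (con 2 :* z)) :* (con 2 :* (p :* (p :* con 1)))
                                     := z :* con 1 :* (p :* (con 8 :* p))) ≡.refl (2 ^ (3 + m)) p ⟩
  2 ^ (3 + m) * 1 * (p * (8 * p)) ≤⟨ ℕₚ.*-monoʳ-≤ (2 ^ (3 + m) * 1) (ℕₚ.*-monoʳ-≤ p 8p≤γ) ⟩
  2 ^ (3 + m) * 1 * (p * γ (3 + m)) ∎)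
  where
  open +-*-Solver
  p = 5 + m
  f = chernoff 2 1 1 (3 + m) 1 (ℕ.s≤s ℕ.z≤n)
  W = ℕL.sum (List.map f (upTo (suc (4 + m))))
  f≡ : ∀ i → f i ≡ 2 ^ ((4 + m) ∸ i)
  f≡ i = ≡.trans (≡.cong₂ (λ x y → 2 ^ (x ∸ 1 * i) * y) (ℕₚ.+-comm (3 + m) 1) (ℕₚ.^-zeroˡ (1 * i)))
    (≡.trans (ℕₚ.*-identityʳ _) (≡.cong (λ x → 2 ^ ((4 + m) ∸ x)) (ℕₚ.*-identityˡ i)))
  W≤ : W ≤ 2 ^ (5 + m)
  W≤ = ℕₚ.≤-trans (ℕₚ.≤-reflexive (≡.cong ℕL.sum (Listₚ.map-upTo f (suc (4 + m)))))
    (ℕₚ.≤-trans (ℕₚ.n≤1+n _) (geometric (4 + m) f≡))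
  8p≤γ : 8 * p ≤ γ (3 + m)
  8p≤γ = ℕₚ.m+n≤o⇒m≤o (8 * p) (ℕₚ.≤-reflexive (solve 1 (λ m → con 8 :* (con 5 :+ m) :+ (con 1 :+ con 6 :* m :+ m :* m)
    := (con 3 :+ m) :* (con 3 :+ m) :+ con 8 :* (con 3 :+ m) :+ con 8) ≡.refl m))
  sum≤n : ∀ (a : Vec ℕ n) → LowDegree p n a → 1 * Vec.sum a ≤ n * 1
  sum≤n a low = begin
    1 * Vec.sum a ≡⟨ ℕₚ.*-identityˡ _ ⟩
    Vec.sum a     ≤⟨ ℕₚ.*-cancelˡ-≤ p (ℕₚ.≤-trans low (ℕₚ.≤-trans (ℕₚ.*-monoʳ-≤ n (ℕₚ.n≤1+n (4 + m))) (ℕₚ.≤-reflexive (ℕₚ.*-comm n p)))) ⟩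
    n             ≡⟨ ℕₚ.*-identityʳ n ⟨
    n * 1         ∎

-- From extremal sequences to the EGZ constant

Property-D-bound : ∀ j n {S T : Seq (2 + j) n} → Prime (2 + j) → 1 ≤ j → S ↭ rep (1 + j) T → ¬ HasZSLen (2 + j) S →
                   List.length S * (2 * (2 + j) ^ 2) ^ n ≤ ((1 + j) * (2 + j) ^ (n + 1)) * γ j ^ n
Property-D-bound j n {S} {T} prime-p 1≤j S↭ none = begin
  List.length S * b ^ n
    ≡⟨ ≡.cong (_* b ^ n) (≡.trans (Perm.↭-length S↭) (length-rep (1 + j) T)) ⟩
  (1 + j) * List.length T * b ^ n
    ≤⟨ ℕₚ.*-monoˡ-≤ (b ^ n) (ℕₚ.*-monoʳ-≤ (1 + j) (slice-rank-bound prime-p {T = T} S↭ none L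
         λ {a} bounded low → ∈-filter⁺ (lowDegree? p n) (∈-boundedVecs bounded) low)) ⟩
  (1 + j) * (p * List.length L) * b ^ n
    ≡⟨ solve 4 (λ q p l b → q :* (p :* l) :* b := q :* p :* (l :* b)) ≡.refl (1 + j) p (List.length L) (b ^ n) ⟩
  (1 + j) * p * (List.length L * b ^ n)
    ≤⟨ ℕₚ.*-monoʳ-≤ ((1 + j) * p) (lowDegreeVecs-count j n prime-p 1≤j) ⟩
  (1 + j) * p * (p * γ j) ^ n
    ≡⟨ ≡.cong ((1 + j) * p *_) (^-distribʳ-* n p (γ j)) ⟩
  (1 + j) * p * (p ^ n * γ j ^ n)
    ≡⟨ solve 4 (λ q p x y → q :* p :* (x :* y) := q :* (x :* (p :* con 1)) :* y) ≡.refl (1 + j) p (p ^ n) (γ j ^ n) ⟩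
  (1 + j) * (p ^ n * p ^ 1) * γ j ^ n
    ≡⟨ ≡.cong (λ x → (1 + j) * x * γ j ^ n) (ℕₚ.^-distribˡ-+-* p n 1) ⟨
  (1 + j) * p ^ (n + 1) * γ j ^ n ∎
  where
  open +-*-Solver
  p = 2 + j
  b = 2 * p ^ 2
  L = lowDegreeVecs p n

egz-MulExpLe : ∀ j n N M → N * (2 * (2 + j) ^ 2) ^ n ≤ M * γ j ^ n → MulExpLe N (egzX (2 + j) n) M
egz-MulExpLe j n = Exponential.MulExpLe-/ (j ^ 2) (γ j) (2 * (2 + j) ^ 2) {{_}} {{γ-nonZero}} γ+j² n
  where
  γ-nonZero : ℕ.NonZero (γ j)
  γ-nonZero = ℕ.>-nonZero (ℕₚ.≤-trans (ℕ.s≤s ℕ.z≤n) (ℕₚ.m≤n+m 8 (j * j + 8 * j)))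
  γ+j² : γ j + j ^ 2 ≡ 2 * (2 + j) ^ 2
  γ+j² = solve 1 (λ j → (j :* j :+ con 8 :* j :+ con 8) :+ j :* (j :* con 1)
                        := con 2 :* ((con 2 :+ j) :* ((con 2 :+ j) :* con 1))) ≡.refl j
    where open +-*-Solver

theorem1p6 : ∀ (p n s : ℕ) → Prime p → p > 2 → n ≥ 1 → IsEGZConstant p n s → PropertyD p n s → MulExpLe (s ∸ 1) (egzX p n) ((p ∸ 1) * p ^ (n Data.Nat.+ 1))
-- For s = 0 truncated subtraction makes s - 1 zero, and the bound is trivial.
theorem1p6 (suc (suc j)) n zero    prime-p p>2 _ _ _ = egz-MulExpLe j n 0 ((1 + j) * (2 + j) ^ (n + 1)) ℕ.z≤n
theorem1p6 (suc (suc j)) n (suc s) prime-p p>2 _ (egz , least) propertyD k =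
  -- The constant is `suc s` here. If the bound fails, s already has the EGZ property: longer
  -- sequences are covered by `egz`, and one of length s without a zero-sum subsequence would, by
  -- Property D, yield the bound.
  decidable-stable (_ ℚₚ.≤? _) λ ¬bound → ℕₚ.1+n≰n (least s λ S s≤|S| → zeroSum ¬bound S (ℕₚ.m≤n⇒m<n∨m≡n s≤|S|))
  where
  p = 2 + j
  Bound = (+ s ℚ./ 1) ℚ.* expPartial (egzX p n) k ℚ.≤ + ((p ∸ 1) * p ^ (n + 1)) ℚ./ 1

  zeroSum : ¬ Bound → ∀ S → s ℕ.< List.length S ⊎ s ≡ List.length S → HasZSLen p S
  zeroSum ¬bound S (inj₁ s<|S|)  = egz S s<|S|
  zeroSum ¬bound S (inj₂ ≡.refl) with hasZSLen? p S
  ... | yes has = has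
  ... | no none with propertyD S ≡.refl none
  ... | T , S↭  = contradiction (egz-MulExpLe j n s ((p ∸ 1) * p ^ (n + 1))
      (Property-D-bound j n {T = T} prime-p (ℕ.s≤s⁻¹ (ℕ.s≤s⁻¹ p>2)) S↭ none) k) ¬bound
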